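{- Let $n,r$ be positive integers and $S,T\subseteq[n]$. The statistics $\mathrm{cr}(\overline\Lambda)$ and $\mathrm{ne}(\overline\Lambda)$ have a symmetric joint distribution over all $r$-colored enhanced partitions $\overline\Lambda$ of $[n]$ with $\min(\overline\Lambda)\setminus\max(\overline\Lambda)=S$ and $\max(\overline\Lambda)\setminus\min(\overline\Lambda)=T$; that is, for all $a,b$ the number of such $\overline\Lambda$ with $(\mathrm{cr},\mathrm{ne})=(a,b)$ equals the number with $(\mathrm{cr},\mathrm{ne})=(b,a)$.
   Context: For a partition $P$ of $[n]=\{1,\dots,n\}$, $\mathrm{Arc}(P)$ is the set of pairs $(i,j)$ with $i,j$ in the same block and $j$ the least element of that block greater than $i$; $\min(P)$, $\max(P)$ are the sets of minimal and maximal elements of blocks. The enhanced arc set is $\overline{\mathrm{Arc}}(P)=\mathrm{Arc}(P)\cup\{(i,i):i\in\min(P)\cap\max(P)\}$. An $r$-colored enhanced partition is $\overline\Lambda=(P,\varphi)$ with $\varphi:\overline{\mathrm{Arc}}(P)\to[r]$, $\min(\overline\Lambda)=\min(P)$, $\max(\overline\Lambda)=\max(P)$; $\mathrm{cr}(\overline\Lambda)$ ($\mathrm{ne}(\overline\Lambda)$) is the largest $k$ such that there are $k$ enhanced arcs $(i_t,j_t)$ all of the same color with $i_1<\dots<i_k\le j_1<\dots<j_k$ (resp. $i_1<\dots<i_k\le j_k<\dots<j_1$). -}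

module Defs where

open import Data.Nat using (ℕ; zero; suc)
open import Data.Bool using (Bool; T)
open import Data.Fin using (Fin; zero; suc; fromℕ; _<_; _≤_)
open import Data.Fin.Subset using (Subset; _∈_)
open import Data.Vec using (Vec; lookup)
open import Data.Maybe using (Maybe; just; is-just)
open import Data.Product using (Σ; ∃; _×_; _,_)
open import Data.Sum using (_⊎_)
open import Relation.Nullary using (¬_)
open import Relation.Binary.PropositionalEquality using (_≡_)
open import Function.Bundles using (_⇔_)

BoolRel : ℕ → Set
BoolRel n = Vec (Vec Bool n) n

_∼[_]_ : ∀ {n} → Fin n → BoolRel n → Fin n → Set
i ∼[ R ] j = T (lookup (lookup R i) j)

-- A set partition of [n], given by its "same block" relation,
-- which must be an equivalence relation.
record IsSetPartition {n : ℕ} (R : BoolRel n) : Set where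
  field
    reflexive  : ∀ i → i ∼[ R ] i
    symmetric  : ∀ i j → i ∼[ R ] j → j ∼[ R ] i
    transitive : ∀ i j k → i ∼[ R ] j → j ∼[ R ] k → i ∼[ R ] k

Arc : ∀ {n} → BoolRel n → Fin n → Fin n → Set
Arc R i j = i < j × i ∼[ R ] j × (∀ k → i < k → k ∼[ R ] i → j ≤ k)

IsMin : ∀ {n} → BoolRel n → Fin n → Set
IsMin R i = ∀ k → k ∼[ R ] i → i ≤ k

IsMax : ∀ {n} → BoolRel n → Fin n → Set
IsMax R i = ∀ k → k ∼[ R ] i → k ≤ i

EnhancedArc : ∀ {n} → BoolRel n → Fin n → Fin n → Set
EnhancedArc R i j = Arc R i j ⊎ (i ≡ j × IsMin R i × IsMax R i)

-- An r-colored enhanced partition (P , φ) of [n]. The colouring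
-- φ : Arc‾(P) → [r] is stored as an n×n matrix of partial values whose
-- support is exactly the enhanced arc set. The proof fields are
-- irrelevant, so two such objects are equal iff their data agree.
record ColoredEnhancedPartition (n r : ℕ) : Set where
  constructor mkCEP
  field
    blocks  : BoolRel n
    colour  : Vec (Vec (Maybe (Fin r)) n) n
    .isPart : IsSetPartition blocks
    .domain : ∀ i j → T (is-just (lookup (lookup colour i) j)) ⇔ EnhancedArc blocks i j

module _ {n r : ℕ} (Λ : ColoredEnhancedPartition n r) where
  open ColoredEnhancedPartition Λ

  φ : Fin n → Fin n → Maybe (Fin r)
  φ i j = lookup (lookup colour i) j

  ColouredArc : Fin r → Fin n → Fin n → Set
  ColouredArc c i j = EnhancedArc blocks i j × φ i j ≡ just c

  HasCrossing : ℕ → Set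
  HasCrossing zero = Data.Unit.⊤ where import Data.Unit
  HasCrossing (suc m) =
    Σ (Fin r) λ c → Σ (Fin (suc m) → Fin n) λ is → Σ (Fin (suc m) → Fin n) λ js →
      (∀ t → ColouredArc c (is t) (js t)) ×
      (∀ s t → s < t → is s < is t) ×
      (∀ s t → s < t → js s < js t) ×
      (is (fromℕ m) ≤ js zero)

  HasNesting : ℕ → Set
  HasNesting zero = Data.Unit.⊤ where import Data.Unit
  HasNesting (suc m) =
    Σ (Fin r) λ c → Σ (Fin (suc m) → Fin n) λ is → Σ (Fin (suc m) → Fin n) λ js →
      (∀ t → ColouredArc c (is t) (js t)) ×
      (∀ s t → s < t → is s < is t) ×
      (∀ s t → s < t → js t < js s) ×
      (is (fromℕ m) ≤ js (fromℕ m))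

  CrIs : ℕ → Set
  CrIs a = HasCrossing a × (∀ k → HasCrossing k → k Data.Nat.≤ a)

  NeIs : ℕ → Set
  NeIs b = HasNesting b × (∀ k → HasNesting k → k Data.Nat.≤ b)

  MinMinusMaxIs : Subset n → Set
  MinMinusMaxIs S = ∀ i → (i ∈ S) ⇔ (IsMin blocks i × ¬ IsMax blocks i)

  MaxMinusMinIs : Subset n → Set
  MaxMinusMinIs S = ∀ i → (i ∈ S) ⇔ (IsMax blocks i × ¬ IsMin blocks i)

open import Data.Refinement using (Refinement)

Class : (n r : ℕ) → Subset n → Subset n → ℕ → ℕ → Set
Class n r S T a b = Refinement (ColoredEnhancedPartition n r) λ Λ →
  MinMinusMaxIs Λ S × MaxMinusMinIs Λ T × CrIs Λ a × NeIs Λ b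

{-# OPTIONS --safe #-}
module Submission where

-- An enhanced partition is a matching of openings with closings in a word: an element of S only opens an arc,
-- one of T only closes one, and every other element opens an arc and then closes one.  Colour classes do not
-- interact, so it suffices to find, for each colour, an involution on the matchings of a fixed word of openings
-- and closings that exchanges crossings and nestings.  Reading the word from right to left, insert the left
-- endpoint of an arc by RSK when the arc is closed and delete it (it is then the largest entry) when the arc is
-- opened.  The matching is recovered from the resulting closed walk in Young's lattice, and by Schensted's theorem
-- its largest crossing (nesting) is the largest number of rows (columns) of a shape on the walk.  The involution
-- transposes all shapes.

open import Defs
open import Data.Bool using () renaming (T to True)
import Data.Bool.Properties as Boolₚ
open import Data.Empty using (⊥)
open import Data.Fin as Fin using (Fin; toℕ; fromℕ; opposite)
import Data.Fin.Induction as FinInd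
import Data.Fin.Properties as Finₚ
open import Data.Fin.Subset using (Subset)
open import Data.Irrelevant using ([_])
open import Data.List as List using (List; []; _∷_; _++_; map; length; filter; allFin)
open import Data.List.Membership.Propositional using (_∈_)
open import Data.List.Membership.Propositional.Properties using (∈-map⁺; ∈-map⁻; ∈-filter⁺; ∈-filter⁻; ∈-++⁺ˡ; ∈-++⁺ʳ; ∈-allFin; ∈-lookup)
open import Data.List.Properties using (filter-accept; filter-reject; filter-all; ∷-injectiveˡ; ∷-injectiveʳ; length-tabulate)
open import Data.List.Relation.Unary.All as All using (All; []; _∷_)
import Data.List.Relation.Unary.All.Properties as Allₚ
open import Data.List.Relation.Unary.AllPairs as AllPairs using (AllPairs; []; _∷_)
import Data.List.Relation.Unary.AllPairs.Properties as AllPairsₚ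
open import Data.List.Relation.Unary.Any as Any using (Any; here; there)
import Data.List.Relation.Unary.Any.Properties as Anyₚ
open import Data.Maybe using (Maybe; just; nothing; is-just)
open import Data.Maybe.Properties using (just-injective)
import Data.Maybe.Properties as Maybeₚ
open import Data.Nat using (ℕ; zero; suc; _+_; _∸_; _⊔_; _≤_; _<_; z≤n; s≤s; z<s; _≟_; _<?_; _≤?_)
open import Data.Nat.Properties
open import Data.Product using (∃; ∃₂; _×_; _,_; proj₁; proj₂; swap)
open import Data.Refinement using (_,_)
open import Data.Sum as Sum using (_⊎_; inj₁; inj₂)
open import Data.Unit using (⊤)
open import Data.Vec using (Vec; lookup; tabulate)
import Data.Vec.Properties as Vecₚ
open import Function using (_∘_; id)
open import Function.Bundles using (_⇔_; mk⇔; Equivalence; _↔_; mk↔ₛ′)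
open import Induction.WellFounded using (Acc; acc)
open import Relation.Binary using (tri<; tri≈; tri>)
open import Relation.Binary.PropositionalEquality
open import Relation.Nullary using (¬_; ¬?; yes; no; Dec; contradiction; recompute)
open import Relation.Nullary.Decidable using (map′; _×-dec_; ⌊_⌋; toWitness; fromWitness; T?)
open Equivalence using (to; from)

-- Openings are met in decreasing order, so the label to delete heads the list of entries; insertion
-- builds the tail without consulting the head, so the tail is the insertion tableau of the arcs
-- still pending. As an element opens before it closes, the inequality i_k ≤ j_1 is the order of two
-- events and a loop is an arc like any other: conjugation may create or destroy singletons, and
-- only the sets S and T are kept. For rows, Schensted's theorem is a direct recursion. For columns,
-- no reversed word is used: the row indices of the entries, by increasing label, form a lattice
-- word whose longest strictly increasing subsequence counts the rows. Insertion puts a new smallest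
-- letter into it and then runs a carry that raises some letters by one; `Carried` is the invariant
-- by which the length survives. Partitions carry irrelevant proofs, so the involution is computed
-- from the colour matrix alone: `insert`, `extract`, `encode`, `decode` and `blocksOf` are total
-- functions, and the relations `Ins` and `Run` state the correctness of the first four.

private variable
  n k r s : ℕ
  x y i j : Fin n

-- Tableaux and row insertion

δ : ℕ → ℕ → ℕ
δ r x with r ≟ x
... | yes _ = 1
... | no  _ = 0

δ-refl : ∀ r → δ r r ≡ 1
δ-refl r with r ≟ r
... | yes _ = refl
... | no r≢r = contradiction refl r≢r

δ-≢ : ∀ {r x} → r ≢ x → δ r x ≡ 0
δ-≢ {r} {x} r≢x with r ≟ x
... | yes r≡x = contradiction r≡x r≢x
... | no _ = refl

-- A standard tableau is given by its entries in decreasing order, each with the (0-based) row containing it.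
Tableau : ℕ → Set
Tableau n = List (Fin n × ℕ)

private variable
  T T′ : Tableau n

count : ℕ → Tableau n → ℕ
count q [] = 0
count q ((_ , s) ∷ T) = δ s q + count q T

Sorted : Tableau n → Set
Sorted = AllPairs (λ a b → proj₁ b Fin.< proj₁ a)

Lattice : Tableau n → Set
Lattice [] = ⊤
Lattice (e ∷ T) = (∀ q → count (suc q) (e ∷ T) ≤ count q (e ∷ T)) × Lattice T

lattice-≤ : ∀ (T : Tableau n) → Lattice T → ∀ q → count (suc q) T ≤ count q T
lattice-≤ [] _ q = z≤n
lattice-≤ (_ ∷ _) (h , _) = h

-- Row insertion by Fomin's local rules: r is the row of the box by which the new shape exceeds the old one.
data Ins {n} (x : Fin n) : Tableau n → Tableau n → ℕ → Set where
  stop : ∀ {T} → All (λ e → proj₁ e Fin.< x) T → Ins x T ((x , 0) ∷ T) 0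
  pass : ∀ {y s r T T′} → x Fin.< y → s ≢ r → Ins x T T′ r → Ins x ((y , s) ∷ T) ((y , s) ∷ T′) r
  push : ∀ {y r T T′} → x Fin.< y → Ins x T T′ r → Ins x ((y , r) ∷ T) ((y , suc r) ∷ T′) (suc r)

ins-count : Ins x T T′ r → ∀ q → count q T′ ≡ δ r q + count q T
ins-count (stop _) q = refl
ins-count {r = r} (pass {s = s} {T = T} _ _ I) q =
    trans (cong (δ s q +_) (ins-count I q)) (x∙yz≈y∙xz (δ s q) (δ r q) (count q T))
  where open import Algebra.Properties.CommutativeSemigroup +-commutativeSemigroup
ins-count (push {r = r} {T = T} _ I) q = cong (δ (suc r) q +_) (ins-count I q)

ins-all : ∀ {P : Fin n → Set} → Ins x T T′ r → P x → All (P ∘ proj₁) T → All (P ∘ proj₁) T′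
ins-all (stop _) px ps = px ∷ ps
ins-all (pass _ _ I) px (p ∷ ps) = p ∷ ins-all I px ps
ins-all (push _ I) px (p ∷ ps) = p ∷ ins-all I px ps

ins-sorted : Ins x T T′ r → Sorted T → Sorted T′
ins-sorted (stop a) so = a ∷ so
ins-sorted (pass lt _ I) (a ∷ so) = ins-all I lt a ∷ ins-sorted I so
ins-sorted (push lt I) (a ∷ so) = ins-all I lt a ∷ ins-sorted I so

-- Adding a box to row `r` endangers only the inequality with the row above.
corner-grow : ∀ {r} (f f′ : ℕ → ℕ) → (∀ q → f (suc q) ≤ f q) → (∀ q → f′ q ≡ δ r q + f q) →
  (∀ q → suc q ≡ r → f (suc q) < f q) → ∀ q → f′ (suc q) ≤ f′ q
corner-grow {r} f f′ h e k q rewrite e q | e (suc q) with r ≟ suc q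
... | yes refl rewrite δ-≢ {suc q} {q} 1+n≢n = k q refl
... | no _ = ≤-trans (h q) (m≤n+m _ (δ r q))

-- Removing a box from row `r` endangers only the inequality with the row below, which is strict at
-- a corner.
corner-shrink : ∀ {r} (f f′ : ℕ → ℕ) → (∀ q → f′ (suc q) ≤ f′ q) → (∀ q → f′ q ≡ δ r q + f q) →
  f′ (suc r) < f′ r → ∀ q → f (suc q) ≤ f q
corner-shrink {r} f f′ h e k q with r ≟ q
... | yes refl rewrite e r | e (suc r) | δ-refl r | δ-≢ {r} {suc r} (1+n≢n ∘ sym) = ≤-pred k
... | no r≢q = ≤-trans (m≤n+m _ (δ r (suc q))) (≤-trans (≤-reflexive (sym (e (suc q)))) (≤-trans (h q)
    (≤-reflexive (trans (e q) (cong (_+ f q) (δ-≢ r≢q))))))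

-- At the last push, the smaller entries satisfy the weak inequality, and the pushed entry, counted
-- in row `q` of the old tableau, makes it strict.
ins-addable : Ins x T T′ r → Lattice T → ∀ q → suc q ≡ r → count r T < count q T
ins-addable (pass {s = s} {r = r} {T = T} lt s≢r I) (_ , l) q refl
  rewrite δ-≢ s≢r = ≤-trans (ins-addable I l q refl) (m≤n+m _ (δ s q))
ins-addable (push {r = r} {T = T} lt I) (_ , l) .r refl
  rewrite δ-refl r | δ-≢ {r} {suc r} (1+n≢n ∘ sym) = s≤s (lattice-≤ T l r)

ins-lattice-≤ : Ins x T T′ r → Lattice T → ∀ q → count (suc q) T′ ≤ count q T′
ins-lattice-≤ {T = T} {T′ = T′} I l = corner-grow (λ q → count q T) (λ q → count q T′) (lattice-≤ T l) (ins-count I)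
  (λ { q refl → ins-addable I l q refl })

ins-lattice : Ins x T T′ r → Lattice T → Lattice T′
ins-lattice I@(stop _) l = ins-lattice-≤ I l , l
ins-lattice I@(pass _ _ J) l = ins-lattice-≤ I l , ins-lattice J (proj₂ l)
ins-lattice I@(push _ J) l = ins-lattice-≤ I l , ins-lattice J (proj₂ l)

insert : Fin n → Tableau n → Tableau n × ℕ
bump : Fin n → ℕ → Tableau n × ℕ → Tableau n × ℕ

insert x [] = (x , 0) ∷ [] , 0
insert x ((y , s) ∷ T) with x Finₚ.<? y
... | no _  = (x , 0) ∷ (y , s) ∷ T , 0
... | yes _ = bump y s (insert x T)

bump y s (T , r) with s ≟ r
... | yes _ = (y , suc r) ∷ T , suc r
... | no  _ = (y , s) ∷ T , r

insert-ins : Ins x T T′ r → insert x T ≡ (T′ , r)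
insert-ins {T = []} (stop _) = refl
insert-ins {x = x} {T = (y , s) ∷ T} (stop (lt ∷ _)) with x Finₚ.<? y
... | yes gt = contradiction gt (<⇒≯ lt)
... | no _ = refl
insert-ins {x = x} (pass {y = y} {s = s} {r = r} lt s≢r I) with x Finₚ.<? y
... | no ≮ = contradiction lt ≮
... | yes _ rewrite insert-ins I with s ≟ r
... | yes e = contradiction e s≢r
... | no _ = refl
insert-ins {x = x} (push {y = y} {r = r} lt I) with x Finₚ.<? y
... | no ≮ = contradiction lt ≮
... | yes _ rewrite insert-ins I with r ≟ r
... | no e = contradiction refl e
... | yes _ = refl

-- Off a corner the scan runs out of entries; the default label is then returned.
extract : Fin n → ℕ → Tableau n → Fin n × Tableau n
extract d r [] = d , []
extract d r ((y , s) ∷ T) with s ≟ r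
extract d r       ((y , s) ∷ T) | no _ = let x , T₁ = extract d r T in x , (y , s) ∷ T₁
extract d zero    ((y , s) ∷ T) | yes _ = y , T
extract d (suc r) ((y , s) ∷ T) | yes _ = let x , T₁ = extract d r T in x , (y , r) ∷ T₁

extract-ins : ∀ d → Ins x T T′ r → extract d r T′ ≡ (x , T)
extract-ins d (stop _) = refl
extract-ins d (pass {s = s} {r = r} _ s≢r I) with s ≟ r
... | yes e = contradiction e s≢r
... | no _ rewrite extract-ins d I = refl
extract-ins d (push {r = r} _ I) with suc r ≟ suc r
... | no e = contradiction refl e
... | yes _ rewrite extract-ins d I = refl

ins-all⁻ : ∀ {P : Fin n → Set} → Ins x T T′ r → All (P ∘ proj₁) T′ → P x × All (P ∘ proj₁) T
ins-all⁻ (stop _) (p ∷ ps) = p , ps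
ins-all⁻ (pass _ _ I) (p ∷ ps) = let q , qs = ins-all⁻ I ps in q , p ∷ qs
ins-all⁻ (push _ I) (p ∷ ps) = let q , qs = ins-all⁻ I ps in q , p ∷ qs

-- Scanning from the largest entry, the first one found in row `r` was either inserted there (row 0)
-- or pushed from the row above; in the latter case the lattice condition at this entry makes the
-- row above end in a corner of the tail, where the scan goes on.
uninsert : ∀ r (T′ : Tableau n) → Sorted T′ → Lattice T′ → count (suc r) T′ < count r T′ →
  ∃₂ λ x T → Ins x T T′ r × Sorted T × Lattice T
uninsert r ((y , s) ∷ T′) (a ∷ so) l@(h , l₁) k with s ≟ r
uninsert zero ((y , s) ∷ T′) (a ∷ so) l@(h , l₁) k | yes refl = y , T′ , stop a , so , l₁
uninsert (suc q) ((y , s) ∷ T′) (a ∷ so) l@(h , l₁) k | yes refl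
  with x , T , I , so₁ , l₂ ← uninsert q T′ so l₁ (subst₂ _≤_ (cong (_+ count (suc q) T′) (δ-refl (suc q)))
      (cong (_+ count q T′) (δ-≢ 1+n≢n)) (h q))
  with lt , a₁ ← ins-all⁻ {P = Fin._< y} I a
  = let I′ = push lt I in x , (y , q) ∷ T , I′ , a₁ ∷ so₁ ,
    corner-shrink (λ q′ → count q′ ((y , q) ∷ T)) (λ q′ → count q′ ((y , suc q) ∷ T′)) h (ins-count I′)
        (subst (count (suc (suc q)) ((y , suc q) ∷ T′) <_) (cong (_+ count (suc q) T′) (sym (δ-refl (suc q)))) k) , l₂
uninsert r ((y , s) ∷ T′) (a ∷ so) l@(h , l₁) k | no s≢r
  with x , T , I , so₁ , l₂ ← uninsert r T′ so l₁ (≤-trans (s≤s (m≤n+m _ (δ s (suc r)))) k)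
  with lt , a₁ ← ins-all⁻ {P = Fin._< y} I a
  = let I′ = pass lt s≢r I in x , (y , s) ∷ T , I′ , a₁ ∷ so₁ ,
    corner-shrink (λ q′ → count q′ ((y , s) ∷ T)) (λ q′ → count q′ ((y , s) ∷ T′)) h (ins-count I′)
        (subst (count (suc r) ((y , s) ∷ T′) <_) (cong (_+ count r T′) (sym (δ-≢ s≢r))) k) , l₂

-- Schensted's theorem

≤-⊔-right : ∀ {k a b} → k ≤ a ⊔ b → ¬ (k ≤ a) → k ≤ b
≤-⊔-right {k} {a} {b} le ≰ with ⊔-sel a b
... | inj₁ e = contradiction (subst (k ≤_) e le) ≰
... | inj₂ e = subst (k ≤_) e le

module Chains {A : Set} (P : ℕ → A → Set) (P? : ∀ z x → Dec (P z x)) (next : A → ℕ)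
              (P-trans : ∀ {z x y} → P z x → P (next x) y → P z y) where

  longest : List A → ℕ → ℕ
  longest [] z = 0
  longest (x ∷ D) z with P? z x
  ... | yes _ = longest D z ⊔ suc (longest D (next x))
  ... | no _  = longest D z

  longest-∷ : ∀ x D z → longest D z ≤ longest (x ∷ D) z
  longest-∷ x D z with P? z x
  ... | yes _ = m≤m⊔n _ _
  ... | no _  = ≤-refl

  longest-∷′ : ∀ {x D z} → P z x → suc (longest D (next x)) ≤ longest (x ∷ D) z
  longest-∷′ {x} {D} {z} p with P? z x
  ... | yes _ = m≤n⊔m _ _
  ... | no ¬p = contradiction p ¬p

  module _ {Q : A → A → Set} where

    Chain : List A → Set
    Chain = AllPairs (λ x y → P (next x) y × Q x y)

    -- `D` is itself sorted by the asymmetric `Q`, so a `Q`-increasing list of members of `D` is a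
    -- sublist of `D`, and membership is all that has to be assumed.
    chain⇒longest : (∀ {x y} → Q x y → ¬ Q y x) → ∀ {D} z xs → AllPairs Q D → Chain xs → All (P z) xs → All (_∈ D) xs →
      length xs ≤ longest D z
    chain⇒longest asym z [] _ _ _ _ = z≤n
    chain⇒longest asym {x ∷ D} z (.x ∷ xs) (_ ∷ qD) (c ∷ cs) (p ∷ ps) (here refl ∷ ms) =
      ≤-trans (s≤s (chain⇒longest asym (next x) xs qD cs (All.map proj₁ c) (All.zipWith drop (c , ms))))
          (longest-∷′ {D = D} p)
      where
      drop : ∀ {y} → (P (next x) y × Q x y) × y ∈ x ∷ D → y ∈ D
      drop ((_ , q) , here refl) = contradiction q (asym q)
      drop (_ , there m) = m
    chain⇒longest asym {x ∷ D} z (y ∷ xs) (a ∷ qD) (c ∷ cs) (p ∷ ps) (there m ∷ ms) =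
      ≤-trans (chain⇒longest asym z (y ∷ xs) qD (c ∷ cs) (p ∷ ps) (m ∷ All.zipWith drop (c , ms))) (longest-∷ x D z)
      where
      drop : ∀ {w} → (P (next y) w × Q y w) × w ∈ x ∷ D → w ∈ D
      drop ((_ , q) , here refl) = contradiction (All.lookup a m) (asym q)
      drop (_ , there m) = m

    longest⇒chain : ∀ k z D → AllPairs Q D → k ≤ longest D z →
      ∃ λ xs → length xs ≡ k × Chain xs × All (P z) xs × All (_∈ D) xs
    longest⇒chain zero z D _ _ = [] , refl , [] , [] , []
    longest⇒chain (suc k) z (x ∷ D) (q ∷ qs) le with P? z x
    ... | no _ with xs , l , ch , ps , ms ← longest⇒chain (suc k) z D qs le = xs , l , ch , ps , All.map there ms
    ... | yes p with suc k ≤? longest D z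
    ... | yes le₁ with xs , l , ch , ps , ms ← longest⇒chain (suc k) z D qs le₁ = xs , l , ch , ps , All.map there ms
    ... | no ≰ with xs , l , ch , ps , ms ← longest⇒chain k (next x) D qs (≤-pred (≤-⊔-right le ≰)) = x ∷ xs ,
        cong suc l , All.zipWith (λ (p , m) → p , All.lookup q m) (ps , ms) ∷ ch , p ∷ All.map (P-trans p) ps ,
            here refl ∷ All.map there ms

Arcs : ℕ → Set
Arcs n = List (Fin n × Fin n)

data Rsk {n} : Arcs n → Tableau n → Set where
  []  : Rsk [] []
  _∷_ : ∀ {x j D T T′ r} → Ins x T T′ r → Rsk D T → Rsk ((x , j) ∷ D) T′

rsk-sorted : ∀ {D} → Rsk D T → Sorted T
rsk-sorted [] = []
rsk-sorted (I ∷ R) = ins-sorted I (rsk-sorted R)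

rsk-lattice : ∀ {D} → Rsk D T → Lattice T
rsk-lattice [] = _
rsk-lattice (I ∷ R) = ins-lattice I (rsk-lattice R)

rsk-all : ∀ {D} {P : Fin n → Set} → Rsk D T → All (P ∘ proj₁) T → All (P ∘ proj₁) D
rsk-all [] _ = []
rsk-all {P = P} (I ∷ R) a = let p , b = ins-all⁻ {P = P} I a in p ∷ rsk-all R b

module Down {n} = Chains {Fin n × Fin n} (λ z a → toℕ (proj₁ a) < z) (λ z a → toℕ (proj₁ a) <? z) (toℕ ∘ proj₁)
  (λ p q → <-trans q p)
module Up {n} = Chains {Fin n × Fin n} (λ z a → z ≤ toℕ (proj₁ a)) (λ z a → z ≤? toℕ (proj₁ a)) (suc ∘ toℕ ∘ proj₁)
  (λ p q → ≤-trans p (<⇒≤ q))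

zeros : Tableau n → ℕ → ℕ
zeros [] z = 0
zeros ((y , s) ∷ T) z with toℕ y <? z
... | yes _ = δ s 0 + zeros T z
... | no _ = zeros T z

zeros-all : ∀ {z} → All (λ e → toℕ (proj₁ e) < z) T → zeros T z ≡ count 0 T
zeros-all [] = refl
zeros-all {T = (y , s) ∷ T} {z} (lt ∷ a) with toℕ y <? z
... | yes _ = cong (δ s 0 +_) (zeros-all a)
... | no ≮ = contradiction lt ≮

zeros-≤ : ∀ (T : Tableau n) z → zeros T z ≤ count 0 T
zeros-≤ [] z = z≤n
zeros-≤ ((y , s) ∷ T) z with toℕ y <? z
... | yes _ = +-monoʳ-≤ (δ s 0) (zeros-≤ T z)
... | no _ = ≤-trans (zeros-≤ T z) (m≤n+m _ (δ s 0))

ins-zeros-≥ : ∀ {z} → Ins x T T′ r → z ≤ toℕ x → zeros T′ z ≡ zeros T z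
ins-zeros-≥ {x = x} {z = z} (stop _) le with toℕ x <? z
... | yes lt = contradiction le (<⇒≱ lt)
... | no _ = refl
ins-zeros-≥ {z = z} (pass {y} lt _ I) le with toℕ y <? z
... | yes lt′ = contradiction (≤-trans le (<⇒≤ lt)) (<⇒≱ lt′)
... | no _ = ins-zeros-≥ I le
ins-zeros-≥ {z = z} (push {y} lt I) le with toℕ y <? z
... | yes lt′ = contradiction (≤-trans le (<⇒≤ lt)) (<⇒≱ lt′)
... | no _ = ins-zeros-≥ I le

zeros-skip : ∀ {z} → z ≤ toℕ y → zeros ((y , s) ∷ T) z ≡ zeros T z
zeros-skip {y = y} {z = z} le with toℕ y <? z
... | yes lt = contradiction le (<⇒≱ lt)
... | no _ = refl

ins-count-zeros : ∀ {z} → Ins x T T′ r → All (λ e → toℕ (proj₁ e) < z) T → toℕ x < z → zeros T′ z ≡ δ r 0 + zeros T z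
ins-count-zeros {r = r} {z = z} I a lt =
  trans (zeros-all (ins-all {P = λ y → toℕ y < z} I lt a)) (trans (ins-count I 0) (cong (δ r 0 +_) (sym (zeros-all a))))

-- If row 0 has an entry between `x` and `z`, the least one is bumped: the count stays, and it
-- already exceeds the count below `x`. Otherwise the counts below `z` and below `x` coincide, and
-- `x` adds one.
ins-zeros-< : ∀ {z} → Ins x T T′ r → Sorted T → toℕ x < z → zeros T′ z ≡ zeros T z ⊔ suc (zeros T (toℕ x))
ins-zeros-< {x = x} {T = T} {z = z} (stop a) _ lt with toℕ x <? z
... | no ≮ = contradiction lt ≮
... | yes _ rewrite zeros-all a | zeros-all (All.map (λ p → <-trans p lt) a) = sym (m≤n⇒m⊔n≡n (n≤1+n _))
ins-zeros-< {x = x} {z = z} I@(pass {y} {s} {r} {T} {T′} x<y s≢r J) (a ∷ so) lt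
  rewrite zeros-skip {y = y} {s = s} {T = T} (<⇒≤ x<y) with toℕ y <? z
... | no _ = ins-zeros-< J so lt
... | yes y<z with s ≟ 0
... | no _ = ins-zeros-< J so lt
... | yes refl = trans (cong suc e) (sym (m≥n⇒m⊔n≡m
    (s≤s (≤-trans (n≤1+n _) (≤-trans (m≤n⊔m (zeros T z) _) (≤-reflexive (trans (sym (ins-zeros-< J so lt)) e)))))))
  where
  e : zeros T′ z ≡ zeros T z
  e = trans (ins-count-zeros {z = z} J (All.map (λ p → <-trans p y<z) a) lt) (cong (_+ zeros T z) (δ-≢ (s≢r ∘ sym)))
ins-zeros-< {x = x} {z = z} (push {y} {r} {T} {T′} x<y J) (a ∷ so) lt
  rewrite zeros-skip {y = y} {s = r} {T = T} (<⇒≤ x<y) with toℕ y <? z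
... | no _ = ins-zeros-< J so lt
... | yes y<z with r ≟ 0
... | no _ = ins-zeros-< J so lt
... | yes refl = trans e (sym (m≥n⇒m⊔n≡m (s≤s (≤-trans (zeros-≤ T (toℕ x)) (≤-reflexive (sym (zeros-all b)))))))
  where
  b = All.map (λ p → <-trans p y<z) a
  e : zeros T′ z ≡ suc (zeros T z)
  e = ins-count-zeros {z = z} J b lt

-- The bound `z` is the generalisation under which row 0 and the longest chain obey the same
-- recursion. With `z` above all labels this is Schensted's theorem for rows.
rsk-zeros : ∀ {D} → Rsk D T → ∀ z → zeros T z ≡ Down.longest D z
rsk-zeros [] z = refl
rsk-zeros (_∷_ {x} {j} {D} I R) z with toℕ x <? z
... | yes lt = trans (ins-zeros-< I (rsk-sorted R) lt) (cong₂ (λ a b → a ⊔ suc b) (rsk-zeros R z) (rsk-zeros R (toℕ x)))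
... | no ≮ = trans (ins-zeros-≥ I (≮⇒≥ ≮)) (rsk-zeros R z)

-- Increasing subsequences under a carry

-- A table `g` gives the length of a longest strictly increasing subsequence with letters below the
-- argument; this is its update when the letter `s` is appended to the word.
ext : ℕ → (ℕ → ℕ) → ℕ → ℕ
ext s g v with s <? v
... | yes _ = g v ⊔ suc (g s)
... | no _  = g v

ext-< : ∀ {s v} g → s < v → ext s g v ≡ g v ⊔ suc (g s)
ext-< {s} {v} g lt with s <? v
... | yes _ = refl
... | no ≮ = contradiction lt ≮

ext-≥ : ∀ {s v} g → v ≤ s → ext s g v ≡ g v
ext-≥ {s} {v} g le with s <? v
... | yes lt = contradiction le (<⇒≱ lt)
... | no _ = refl

ext-grows : ∀ s g v → g v ≤ ext s g v
ext-grows s g v with s <? v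
... | yes _ = m≤m⊔n _ _
... | no _ = ≤-refl

-- A larger bound admits more letters, and a single further letter value is used at most once in a
-- strictly increasing subsequence.
record Slow (g : ℕ → ℕ) : Set where
  field
    mono : ∀ {u v} → u ≤ v → g u ≤ g v
    slow : ∀ v → g (suc v) ≤ suc (g v)
open Slow

ext-slow : ∀ {g} s → Slow g → Slow (ext s g)
mono (ext-slow {g} s G) {u} {v} u≤v with s <? u
... | no _ = ≤-trans (mono G u≤v) (ext-grows s g v)
... | yes s<u rewrite ext-< g (<-≤-trans s<u u≤v) = ⊔-monoˡ-≤ (suc (g s)) (mono G u≤v)
slow (ext-slow {g} s G) v with s <? v | s <? suc v
... | yes s<v | yes _ = ⊔-lub (≤-trans (slow G v) (s≤s (m≤m⊔n _ _))) (≤-trans (m≤n⊔m (g v) (suc (g s))) (n≤1+n _))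
... | yes s<v | no ≮ = contradiction (m<n⇒m<1+n s<v) ≮
... | no _ | no _ = slow G v
... | no ≮ | yes s<1+v rewrite ≤-antisym (≤-pred s<1+v) (≮⇒≥ ≮) = ⊔-lub (slow G v) ≤-refl

-- g and h measure, as functions of an upper bound on the letters, the longest strictly increasing
-- subsequence of a word before and after a carry has run through it; r is the carry reached.
record Carried (r : ℕ) (g h : ℕ → ℕ) : Set where
  field
    slow-g : Slow g
    slow-h : Slow h
    above  : ∀ v → r < v → h v ≡ g v
    below  : ∀ v → h v ≤ g v
    jump   : ∀ v → v ≤ r → h v ≡ g v ⊎ g v + (r ∸ v) ≤ h (suc r)
    flat   : g (suc r) ≤ g r
open Carried

carried-cong : ∀ {r g g′ h h′} → g ≗ g′ → h ≗ h′ → Carried r g h → Carried r g′ h′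
carried-cong {r} {g} {g′} {h} {h′} e f C = record
  { slow-g = slow-cong e (slow-g C)
  ; slow-h = slow-cong f (slow-h C)
  ; above = λ v lt → trans (sym (f v)) (trans (above C v lt) (e v))
  ; below = λ v → subst₂ _≤_ (f v) (e v) (below C v)
  ; jump = λ v le → Sum.map (λ q → trans (sym (f v)) (trans q (e v)))
      (subst₂ (λ a b → a + (r ∸ v) ≤ b) (e v) (f (suc r))) (jump C v le)
  ; flat = subst₂ _≤_ (e (suc r)) (e r) (flat C)
  }
  where
  slow-cong : ∀ {a b : ℕ → ℕ} → a ≗ b → Slow a → Slow b
  slow-cong q S = record { mono = λ {u} {v} le → subst₂ _≤_ (q u) (q v) (mono S le) ; slow = λ v →
      subst₂ (λ a b → a ≤ suc b) (q (suc v)) (q v) (slow S v) }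

carried-refl : ∀ {r g} → Slow g → g (suc r) ≤ g r → Carried r g g
carried-refl S f = record { slow-g = S ; slow-h = S ; above = λ _ _ → refl ; below = λ _ → ≤-refl ; jump = λ _ _ →
    inj₁ refl ; flat = f }

carried-zero : ∀ {r} → Carried r (λ _ → 0) (λ _ → 0)
carried-zero = carried-refl (record { mono = λ _ → z≤n ; slow = λ _ → z≤n }) z≤n

ext-mono : ∀ {g h : ℕ → ℕ} s → (∀ v → g v ≤ h v) → ∀ v → ext s g v ≤ ext s h v
ext-mono s le v with s <? v
... | yes _ = ⊔-mono-≤ (le v) (s≤s (le s))
... | no _ = le v

-- A letter above the carry extends chains measured at `s`, where `above` makes both tables agree.
carried-pass-> : ∀ {r s g h} → r < s → Carried r g h → Carried r (ext s g) (ext s h)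
carried-pass-> {r} {s} {g} {h} r<s C = record
  { slow-g = ext-slow s (slow-g C)
  ; slow-h = ext-slow s (slow-h C)
  ; above = above′
  ; below = ext-mono s (below C)
  ; jump = λ v le → subst₂ (λ a b → a ≡ b ⊎ b + (r ∸ v) ≤ ext s h (suc r)) (sym (ext-≥ h (≤-trans le (<⇒≤ r<s))))
      (sym (ext-≥ g (≤-trans le (<⇒≤ r<s))))
      (Sum.map₂ (λ q → ≤-trans q (ext-grows s h (suc r))) (jump C v le))
  ; flat = subst₂ _≤_ (sym (ext-≥ g r<s)) (sym (ext-≥ g (<⇒≤ r<s))) (flat C)
  }
  where
  above′ : ∀ v → r < v → ext s h v ≡ ext s g v
  above′ v lt with s <? v
  ... | yes _ = cong₂ (λ a b → a ⊔ suc b) (above C v lt) (above C s r<s)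
  ... | no _ = above C v lt

-- If h s falls short of g s then the carried letters already form a longer chain, so the new letter s is useless.
carried-pass-< : ∀ {r s g h} → s < r → Carried r g h → Carried r (ext s g) (ext s h)
carried-pass-< {r} {s} {g} {h} s<r C = record
  { slow-g = ext-slow s (slow-g C)
  ; slow-h = ext-slow s (slow-h C)
  ; above = above′
  ; below = ext-mono s (below C)
  ; jump = jump′
  ; flat = subst₂ _≤_ (sym (ext-< g (m<n⇒m<1+n s<r))) (sym (ext-< g s<r)) (⊔-monoˡ-≤ (suc (g s)) (flat C))
  }
  where
  above′ : ∀ v → r < v → ext s h v ≡ ext s g v
  above′ v lt rewrite ext-< g (<-trans s<r lt) | ext-< h (<-trans s<r lt) | above C v lt with jump C s (<⇒≤ s<r)
  ... | inj₁ e = cong (λ b → g v ⊔ suc b) e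
  ... | inj₂ le = trans (m≥n⇒m⊔n≡m (≤-trans (s≤s (below C s)) gs<)) (sym (m≥n⇒m⊔n≡m gs<))
    where
    gs< : suc (g s) ≤ g v
    gs< = begin
      suc (g s)       ≡⟨ +-comm 1 (g s) ⟩
      g s + 1         ≤⟨ +-monoʳ-≤ (g s) (m<n⇒0<n∸m s<r) ⟩
      g s + (r ∸ s)   ≤⟨ le ⟩
      h (suc r)       ≤⟨ mono (slow-h C) lt ⟩
      h v             ≡⟨ above C v lt ⟩
      g v             ∎
      where open ≤-Reasoning
  up : ∀ {a} → a ≤ h (suc r) → a ≤ ext s h (suc r)
  up le = ≤-trans le (ext-grows s h (suc r))
  jump′ : ∀ v → v ≤ r → ext s h v ≡ ext s g v ⊎ ext s g v + (r ∸ v) ≤ ext s h (suc r)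
  jump′ v v≤r with s <? v
  ... | no _ = Sum.map₂ up (jump C v v≤r)
  ... | yes s<v with jump C v v≤r | jump C s (<⇒≤ s<r) | ≤-total (suc (g s)) (g v)
  ... | inj₁ e  | inj₁ e′ | _ = inj₁ (cong₂ (λ a b → a ⊔ suc b) e e′)
  ... | inj₂ le | _ | inj₁ q rewrite m≥n⇒m⊔n≡m q = inj₂ (up le)
  ... | inj₁ e | inj₂ le | inj₁ q rewrite e = inj₁ (trans (m≥n⇒m⊔n≡m (≤-trans (s≤s (below C s)) q)) (sym (m≥n⇒m⊔n≡m q)))
  ... | inj₂ _ | inj₁ e | inj₂ q rewrite e = inj₁ (trans (m≤n⇒m⊔n≡n (≤-trans (below C v) q)) (sym (m≤n⇒m⊔n≡n q)))
  ... | _ | inj₂ le | inj₂ q rewrite m≤n⇒m⊔n≡n q = inj₂ (up (≤-trans (begin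
      suc (g s) + (r ∸ v) ≡⟨ +-suc (g s) (r ∸ v) ⟨
      g s + suc (r ∸ v)   ≤⟨ +-monoʳ-≤ (g s) (∸-monoʳ-< s<v v≤r) ⟩
      g s + (r ∸ s)       ∎) le))
      where open ≤-Reasoning

-- The old word receives `r`, the new one `suc r`. By `flat` and `above`, `h (suc r)`, `g (suc r)`
-- and `g r` coincide, so both letters end chains of length `suc (g r)`. The raised letter also
-- lengthens the long chain promised by `jump` by one, as the larger carry requires.
carried-push : ∀ {r g h} → Carried r g h → Carried (suc r) (ext r g) (ext (suc r) h)
carried-push {r} {g} {h} C = record
  { slow-g = ext-slow r (slow-g C)
  ; slow-h = ext-slow (suc r) (slow-h C)
  ; above = above′
  ; below = below′
  ; jump = jump′
  ; flat = flat′
  }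
  where
  S = slow-g C
  gr : g (suc r) ≡ g r
  gr = ≤-antisym (flat C) (mono S (n≤1+n r))
  hr : h (suc r) ≡ g r
  hr = trans (above C (suc r) ≤-refl) gr
  above′ : ∀ v → suc r < v → ext (suc r) h v ≡ ext r g v
  above′ v lt rewrite ext-< h lt | ext-< g (<-trans (n<1+n r) lt) =
      cong₂ (λ a b → a ⊔ suc b) (above C v (<-trans (n<1+n r) lt)) hr
  below′ : ∀ v → ext (suc r) h v ≤ ext r g v
  below′ v with suc r <? v
  ... | yes lt = ≤-reflexive (trans (sym (ext-< h lt)) (above′ v lt))
  ... | no _ = ≤-trans (below C v) (ext-grows r g v)
  top : suc (g r) ≤ ext (suc r) h (suc (suc r))
  top rewrite ext-< {suc r} {suc (suc r)} h ≤-refl | hr = m≤n⊔m _ _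
  jump′ : ∀ v → v ≤ suc r → ext (suc r) h v ≡ ext r g v ⊎ ext r g v + (suc r ∸ v) ≤ ext (suc r) h (suc (suc r))
  jump′ v v≤ with m≤n⇒m<n∨m≡n v≤
  ... | inj₂ refl rewrite n∸n≡0 r | +-identityʳ (ext r g (suc r)) | ext-< {r} {suc r} g ≤-refl | gr | m≤n⇒m⊔n≡n
      (n≤1+n (g r)) = inj₂ top
  ... | inj₁ (s≤s v≤r) rewrite ext-≥ {suc r} h v≤ | ext-≥ g v≤r with jump C v v≤r
  ... | inj₁ e = inj₁ e
  ... | inj₂ le rewrite +-∸-assoc 1 v≤r | +-suc (g v) (r ∸ v) = inj₂ (≤-trans (s≤s (≤-trans le (≤-reflexive hr))) top)
  flat′ : ext r g (suc (suc r)) ≤ ext r g (suc r)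
  flat′ rewrite ext-< {r} {suc r} g ≤-refl | ext-< {r} {suc (suc r)} g (n≤1+n (suc r)) | gr | m≤n⇒m⊔n≡n (n≤1+n (g r)) =
    ⊔-lub (≤-trans (slow S (suc r)) (s≤s (≤-reflexive gr))) ≤-refl

carried-pass : ∀ {r s g h} → s ≢ r → Carried r g h → Carried r (ext s g) (ext s h)
carried-pass {r} {s} s≢r with <-cmp s r
... | tri< lt _ _ = carried-pass-< lt
... | tri≈ _ e _ = contradiction e s≢r
... | tri> _ _ gt = carried-pass-> gt

-- The longest increasing subsequence of the letters below v, read over the labels from z upwards.
climb : Tableau n → ℕ → ℕ → ℕ
climb [] z v = 0
climb ((y , s) ∷ T) z with z ≤? toℕ y
... | yes _ = ext s (climb T z)
... | no _ = climb T z

climb-take : ∀ {z} → z ≤ toℕ y → climb ((y , s) ∷ T) z ≡ ext s (climb T z)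
climb-take {y = y} {z = z} le with z ≤? toℕ y
... | yes _ = refl
... | no ≰ = contradiction le ≰

climb-skip : ∀ {z} → toℕ y < z → climb ((y , s) ∷ T) z ≡ climb T z
climb-skip {y = y} {z = z} lt with z ≤? toℕ y
... | yes le = contradiction le (<⇒≱ lt)
... | no _ = refl

climb-none : ∀ {z} → All (λ e → toℕ (proj₁ e) < z) T → ∀ v → climb T z v ≡ 0
climb-none [] v = refl
climb-none {T = (y , s) ∷ T} {z} (lt ∷ a) v rewrite climb-skip {y = y} {s = s} {T = T} lt = climb-none a v

climb-slow : ∀ (T : Tableau n) z → Slow (climb T z)
climb-slow [] z = slow-g (carried-zero {0})
climb-slow ((y , s) ∷ T) z with z ≤? toℕ y
... | yes _ = ext-slow s (climb-slow T z)
... | no _ = climb-slow T z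

climb-≤ : ∀ (T : Tableau n) z v → climb T z v ≤ v
climb-≤ T z zero = ≤-reflexive (zero′ T)
  where
  zero′ : ∀ T → climb T z 0 ≡ 0
  zero′ [] = refl
  zero′ ((y , s) ∷ T) with z ≤? toℕ y
  ... | yes _ = trans (ext-≥ {s} (climb T z) z≤n) (zero′ T)
  ... | no _ = zero′ T
climb-≤ T z (suc v) = ≤-trans (slow (climb-slow T z) v) (s≤s (climb-≤ T z v))

-- The inserted label lies below the window of labels from `z` on, so within the window only a
-- passing carry is seen. It enters on empty words, for which every carry is allowed.
ins-carried-above : ∀ {z} → Ins x T T′ r → Sorted T → toℕ x < z → Carried r (climb T z) (climb T′ z)
ins-carried-above {x = x} {z = z} (stop {T} a) _ lt rewrite climb-skip {y = x} {s = 0} {T = T} lt =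
  carried-cong (sym ∘ climb-none b) (sym ∘ climb-none b) carried-zero
  where b = All.map (λ p → <-trans p lt) a
ins-carried-above {z = z} (pass {y} {s} x<y s≢r I) (a ∷ so) lt with z ≤? toℕ y
... | yes _ = carried-pass s≢r (ins-carried-above I so lt)
... | no _ = ins-carried-above I so lt
ins-carried-above {z = z} (push {y} {r} x<y I) (a ∷ so) lt with z ≤? toℕ y
... | yes _ = carried-push (ins-carried-above I so lt)
... | no ≰ = carried-cong (sym ∘ climb-none b) (sym ∘ climb-none (ins-all {P = λ w → toℕ w < z} I lt b)) carried-zero
  where b = All.map (λ p → <-trans p (≰⇒> ≰)) a

-- Raises all letters of the word by one, which frees the letter 0 for the inserted entry.
shift : (ℕ → ℕ) → ℕ → ℕ
shift g zero = 0
shift g (suc v) = g v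

shift-slow : ∀ {g} → Slow g → g 0 ≡ 0 → Slow (shift g)
mono (shift-slow S e) {zero} _ = z≤n
mono (shift-slow S e) {suc u} {suc v} (s≤s le) = mono S le
slow (shift-slow S e) zero = ≤-trans (≤-reflexive e) z≤n
slow (shift-slow S e) (suc v) = slow S v

shift-cong : ∀ {g h : ℕ → ℕ} → g ≗ h → shift g ≗ shift h
shift-cong e zero = refl
shift-cong e (suc v) = e v

shift-ext : ∀ s g → ext (suc s) (shift g) ≗ shift (ext s g)
shift-ext s g zero = ext-≥ {suc s} (shift g) z≤n
shift-ext s g (suc v) with s <? v
... | yes lt = ext-< (shift g) (s≤s lt)
... | no ≮ = ext-≥ (shift g) (s≤s (≮⇒≥ ≮))

-- The climbs of the word of T with a letter smaller than all others inserted at x.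
withNew : Fin n → Tableau n → ℕ → ℕ → ℕ
withNew x T z v = climb T z v ⊔ suc (climb T (suc (toℕ x)) v)

withNew-ext : ∀ {z} → x Fin.< y → z ≤ toℕ x → ext s (withNew x T z) ≗ withNew x ((y , s) ∷ T) z
withNew-ext {x = x} {y = y} {s = s} {T = T} {z} x<y z≤x v
  rewrite climb-take {y = y} {s = s} {T = T} {z = z} (≤-trans z≤x (<⇒≤ x<y)) | climb-take {y = y} {s = s} {T = T} {z =
      suc (toℕ x)} x<y with s <? v
... | yes _ = interchange (climb T z v) (suc (climb T (suc (toℕ x)) v)) (suc (climb T z s))
    (suc (suc (climb T (suc (toℕ x)) s)))
  where open import Algebra.Properties.CommutativeSemigroup ⊔-commutativeSemigroup using (interchange)
... | no _ = refl

-- In the raised alphabet the insertion at `x` is itself a push: the old word gets the new smallest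
-- letter 0, the new word the letter 1, which stands for row 0. From there on the carry is `suc` of
-- the row reached.
ins-carried-below : ∀ {z} → Ins x T T′ r → Sorted T → z ≤ toℕ x →
    Carried (suc r) (shift (withNew x T z)) (shift (climb T′ z))
ins-carried-below {x = x} {z = z} (stop {T} a) so le rewrite climb-take {y = x} {s = 0} {T = T} le =
  carried-cong g-eq (shift-ext 0 (climb T z)) (carried-push {0}
      (carried-refl (shift-slow (climb-slow T z) c0) (≤-reflexive c0)))
  where
  c0 : climb T z 0 ≡ 0
  c0 = n≤0⇒n≡0 (climb-≤ T z 0)
  g-eq : ext 0 (shift (climb T z)) ≗ shift (withNew x T z)
  g-eq zero = refl
  g-eq (suc v) rewrite climb-none {T = T} {z = suc (toℕ x)} (All.map m<n⇒m<1+n a) v = refl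
ins-carried-below {x = x} {z = z} (pass {y} {s} {r} {T} {T′} x<y s≢r I) (a ∷ so) le rewrite climb-take {y = y} {s =
    s} {T = T′} {z = z} (≤-trans le (<⇒≤ x<y)) =
  carried-cong (λ v → trans (shift-ext s _ v) (shift-cong (withNew-ext x<y le) v)) (shift-ext s _)
      (carried-pass (s≢r ∘ suc-injective) (ins-carried-below I so le))
ins-carried-below {x = x} {z = z} (push {y} {r} {T} {T′} x<y I) (a ∷ so) le rewrite climb-take {y = y} {s =
    suc r} {T = T′} {z = z} (≤-trans le (<⇒≤ x<y)) =
  carried-cong (λ v → trans (shift-ext r _ v) (shift-cong (withNew-ext x<y le) v)) (shift-ext (suc r) _)
      (carried-push (ins-carried-below I so le))

ins-letters : ∀ {v} → Ins x T T′ r → All (λ e → proj₂ e < v) T′ → r < v × All (λ e → proj₂ e < v) T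
ins-letters (stop _) (p ∷ a) = p , a
ins-letters (pass _ _ I) (p ∷ a) = let q , b = ins-letters I a in q , p ∷ b
ins-letters (push _ I) (p ∷ a) = let q , b = ins-letters I a in p , q ∷ b

-- A bound `v` above all row indices of the result exceeds every carry on the way, so `above`
-- identifies old and new tables; what is left is the recursion of `Up.longest`.
rsk-climb : ∀ {D} → Rsk D T → ∀ z v → All (λ e → proj₂ e < v) T → climb T z v ≡ Up.longest D z
rsk-climb [] z v _ = refl
rsk-climb (_∷_ {x} {j} {D} I R) z v a with r<v , b ← ins-letters I a with z ≤? toℕ x
... | yes le = trans (above (ins-carried-below I (rsk-sorted R) le) (suc v) (s≤s r<v))
    (cong₂ (λ a b → a ⊔ suc b) (rsk-climb R z v b) (rsk-climb R (suc (toℕ x)) v b))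
... | no ≰ = trans (above (ins-carried-above I (rsk-sorted R) (≰⇒> ≰)) v r<v) (rsk-climb R z v b)

climb-∷ : ∀ e (T : Tableau n) z v → climb T z v ≤ climb (e ∷ T) z v
climb-∷ (y , s) T z v with z ≤? toℕ y
... | yes _ = ext-grows s (climb T z) v
... | no _ = ≤-refl

-- An entry in row `q` is preceded, in label order, by one in row `q - 1`, and so on down to row 0:
-- the letters 0, 1, ..., `q` form a chain.
lattice-climb : ∀ (T : Tableau n) → Lattice T → ∀ q → 0 < count q T → q < climb T 0 (suc q)
lattice-climb ((y , s) ∷ T) (h , l) q k with s ≟ q
... | no _ = ≤-trans (lattice-climb T l q k) (climb-∷ (y , s) T 0 (suc q))
... | yes refl rewrite ext-< {s} {suc s} (climb T 0) ≤-refl = ≤-trans (s≤s (below-s s h)) (m≤n⊔m _ _)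
  where
  below-s : ∀ s → (∀ q → count (suc q) ((y , s) ∷ T) ≤ count q ((y , s) ∷ T)) → s ≤ climb T 0 s
  below-s zero h = z≤n
  below-s (suc q) h = lattice-climb T l q (≤-trans (s≤s z≤n)
      (subst₂ (λ a b → a + count (suc q) T ≤ b + count q T) (δ-refl (suc q)) (δ-≢ {suc q} {q} 1+n≢n) (h q)))

-- Words of openings and closings as walks in Young's lattice

data Event (n : ℕ) : Set where
  op : (i : Fin n) → Event n
  cl : (i j : Fin n) → Event n

-- What conjugation preserves of an event: a closing forgets the left end of its arc.
data Slot (n : ℕ) : Set where
  opens  : (i : Fin n) → Slot n
  closes : (j : Fin n) → Slot n

slot : Event n → Slot n
slot (op i)   = opens i
slot (cl _ j) = closes j

-- At one element the opening stands before the closing. This admits loops and turns the weak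
-- inequality between left and right ends into the order of events.
_≪_ : Slot n → Slot n → Set
opens i  ≪ opens i′  = i Fin.< i′
opens i  ≪ closes j  = i Fin.≤ j
closes j ≪ opens i   = j Fin.< i
closes j ≪ closes j′ = j Fin.< j′

-- One box per event, by row and column; whether it is added or removed is read off the slots.
Path : Set
Path = List (ℕ × ℕ)

transpose : Path → Path
transpose = map swap

transpose-involutive : ∀ p → transpose (transpose p) ≡ p
transpose-involutive [] = refl
transpose-involutive (_ ∷ p) = cong (_ ∷_) (transpose-involutive p)

-- Words are read from right to left: a closing inserts its label and adds a box, an opening removes the box of
-- the largest label.
data Run {n} : List (Event n) → Tableau n → Path → Set where
  []   : Run [] [] []
  open′  : ∀ {u i r T p} → Run u ((i , r) ∷ T) p → Run (op i ∷ u) T ((r , count r T) ∷ p)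
  close′ : ∀ {u i j r T T′ p} → Ins i T T′ r → Run u T p → Run (cl i j ∷ u) T′ ((r , count r T) ∷ p)

rows : List (Slot n) → Path → ℕ → ℕ
rows (opens _ ∷ ss)  ((r , _) ∷ p) q = rows ss p q ∸ δ r q
rows (closes _ ∷ ss) ((r , _) ∷ p) q = δ r q + rows ss p q
rows _ _ q = 0

cols : List (Slot n) → Path → ℕ → ℕ
cols ss p = rows ss (transpose p)

-- The box (r , c) is a corner of the shape with row lengths `rows` and column lengths `cols`: stated through both,
-- validity is invariant under transposition.
Valid : List (Slot n) → Path → Set
Valid [] [] = ⊤
Valid (opens _ ∷ ss)  ((r , c) ∷ p) = rows ss p r ≡ suc c × cols ss p c ≡ suc r × Valid ss p
Valid (closes _ ∷ ss) ((r , c) ∷ p) = rows ss p r ≡ c × cols ss p c ≡ r × Valid ss p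
Valid _ _ = ⊥

valid-transpose : ∀ (ss : List (Slot n)) p → Valid ss p → Valid ss (transpose p)
valid-transpose [] [] _ = _
valid-transpose (opens _ ∷ ss) ((r , c) ∷ p) (a , b , v) =
  b , trans (cong (λ p′ → rows ss p′ r) (transpose-involutive p)) a , valid-transpose ss p v
valid-transpose (closes _ ∷ ss) ((r , c) ∷ p) (a , b , v) =
  b , trans (cong (λ p′ → rows ss p′ r) (transpose-involutive p)) a , valid-transpose ss p v

-- Both inequalities say that the box (r , c) lies in the current shape. Row and column lengths are
-- computed independently of each other, and this is the link between them.
galois : ∀ (ss : List (Slot n)) p → Valid ss p → ∀ r c → c < rows ss p r → r < cols ss p c
galois (opens _ ∷ ss) ((r₀ , c₀) ∷ p) (a , b , v) r c lt with r₀ ≟ r | c₀ ≟ c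
... | no _ | no _ = galois ss p v r c lt
... | yes refl | no _ = galois ss p v r c (<-≤-trans lt (m∸n≤m _ 1))
... | yes refl | yes refl rewrite a = contradiction lt (<-irrefl refl)
... | no r₀≢r | yes refl rewrite b = ≤∧≢⇒< (≤-pred (subst (r <_) b (galois ss p v r c lt))) (r₀≢r ∘ sym)
galois (closes _ ∷ ss) ((r₀ , c₀) ∷ p) (a , b , v) r c lt with r₀ ≟ r | c₀ ≟ c
... | no _ | no _ = galois ss p v r c lt
... | yes refl | no c₀≢c = galois ss p v r c (≤∧≢⇒< (≤-pred lt) (λ e → c₀≢c (trans (sym a) (sym e))))
... | yes refl | yes refl = s≤s (≤-reflexive (sym b))
... | no _ | yes refl = m<n⇒m<1+n (galois ss p v r c lt)

galois⁻ : ∀ (ss : List (Slot n)) p → Valid ss p → ∀ r c → r < cols ss p c → c < rows ss p r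
galois⁻ ss p v r c lt = subst (λ p′ → c < rows ss p′ r) (transpose-involutive p)
    (galois ss (transpose p) (valid-transpose ss p v) c r lt)

-- `Valid` does not mention partitions. They arise because, by `galois`, a column occupies an
-- initial segment of the rows.
rows-decreasing : ∀ (ss : List (Slot n)) p → Valid ss p → ∀ q → rows ss p (suc q) ≤ rows ss p q
rows-decreasing ss p v q = ≮⇒≥ λ lt → <-irrefl refl
    (galois⁻ ss p v q _ (<-trans (n<1+n q) (galois ss p v (suc q) _ lt)))

run-sorted : ∀ {u p} → Run u T p → Sorted T
run-sorted [] = []
run-sorted (open′ R) = AllPairs.tail (run-sorted R)
run-sorted (close′ I R) = ins-sorted I (run-sorted R)

run-lattice : ∀ {u p} → Run u T p → Lattice T
run-lattice [] = _
run-lattice (open′ R) = proj₂ (run-lattice R)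
run-lattice (close′ I R) = ins-lattice I (run-lattice R)

run-count : ∀ {u p} → Run u T p → ∀ q → count q T ≡ rows (map slot u) p q
run-count [] q = refl
run-count (open′ {r = r} {T = T} R) q = trans (sym (m+n∸m≡n (δ r q) (count q T))) (cong (_∸ δ r q) (run-count R q))
run-count (close′ {r = r} I R) q = trans (ins-count I q) (cong (δ r q +_) (run-count R q))

run-valid : ∀ {u p} → Run u T p → Valid (map slot u) p
run-valid [] = _
run-valid (open′ {u} {i} {r} {T} {p} R) = rr , ≤-antisym (≮⇒≥ lt-no)
    (galois ss p v r c (subst (c <_) (sym rr) (n<1+n c))) , v
  where
  ss = map slot u
  c = count r T
  v = run-valid R
  rr : rows ss p r ≡ suc c
  rr = trans (sym (run-count R r)) (cong (_+ c) (δ-refl r))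
  lt-no : ¬ (suc r < cols ss p c)
  lt-no lt = <⇒≱ (galois⁻ ss p v (suc r) c lt) (≤-trans
      (≤-reflexive (trans (sym (run-count R (suc r))) (cong (_+ count (suc r) T) (δ-≢ (1+n≢n ∘ sym)))))
    (lattice-≤ T (proj₂ (run-lattice R)) r))
run-valid (close′ {u} {i} {j} {r} {T} {T′} {p} I R) = rr , ≤-antisym (≮⇒≥ lt-no) (le r refl) , v
  where
  ss = map slot u
  c = count r T
  v = run-valid R
  rr : rows ss p r ≡ c
  rr = sym (run-count R r)
  lt-no : ¬ (r < cols ss p c)
  lt-no lt = <-irrefl (sym rr) (galois⁻ ss p v r c lt)
  le : ∀ r′ → r′ ≡ r → r′ ≤ cols ss p c
  le zero _ = z≤n
  le (suc q) refl = galois ss p v q c (subst (c <_) (run-count R q) (ins-addable I (run-lattice R) q refl))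

encodeOpen : Tableau n × Path → Tableau n × Path
encodeOpen ([] , p) = [] , p
encodeOpen ((_ , r) ∷ T , p) = T , (r , count r T) ∷ p

encodeClose : Fin n → Tableau n × Path → Tableau n × Path
encodeClose i (T , p) = let T′ , r = insert i T in T′ , (r , count r T) ∷ p

encode : List (Event n) → Tableau n × Path
encode [] = [] , []
encode (op i ∷ u) = encodeOpen (encode u)
encode (cl i _ ∷ u) = encodeClose i (encode u)

run-encode : ∀ {u p} → Run u T p → encode u ≡ (T , p)
run-encode [] = refl
run-encode (open′ R) = cong encodeOpen (run-encode R)
run-encode (close′ {i = i} {T = T} {p = p} I R) = trans (cong (encodeClose i) (run-encode R))
    (cong (λ (T′ , r) → T′ , (r , count r T) ∷ p) (insert-ins I))

decode : Tableau n → List (Slot n) → Path → List (Event n)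
decode T (opens i ∷ ss)  ((r , _) ∷ p) = op i ∷ decode ((i , r) ∷ T) ss p
decode T (closes j ∷ ss) ((r , _) ∷ p) = let x , T₁ = extract j r T in cl x j ∷ decode T₁ ss p
decode _ _ _ = []

run-decode : ∀ {u p} → Run u T p → decode T (map slot u) p ≡ u
run-decode [] = refl
run-decode (open′ R) = cong (_ ∷_) (run-decode R)
run-decode (close′ {j = j} I R) rewrite extract-ins j I = cong (_ ∷_) (run-decode R)

count-zero : ∀ (T : Tableau n) → (∀ q → count q T ≡ 0) → T ≡ []
count-zero [] _ = refl
count-zero ((_ , s) ∷ T) e = contradiction (trans (sym (cong (_+ count s T) (δ-refl s))) (e s)) (λ ())

-- The word is now rebuilt from left to right. The labels in `T` have been opened further left, so a
-- newly opened label is the largest and may be put in front. The row lengths agree with the path,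
-- so the box of a closing is a corner and `uninsert` applies; at the end they vanish, so `T` is
-- empty.
decode-run : ∀ (ss : List (Slot n)) p T → Valid ss p → AllPairs _≪_ ss → All (λ e → All (opens (proj₁ e) ≪_) ss) T →
  Sorted T → Lattice T → (∀ q → count q T ≡ rows ss p q) → Run (decode T ss p) T p × map slot (decode T ss p) ≡ ss
decode-run [] [] T _ _ _ _ _ e rewrite count-zero T e = [] , refl
decode-run (opens i ∷ ss) ((r , c) ∷ p) T (a , b , v) (o ∷ os) ls so l e =
  subst (λ c → Run (op i ∷ decode ((i , r) ∷ T) ss p) T ((r , c) ∷ p)) c≡ (open′ R) , cong (_ ∷_) eq
  where
  cnt : ∀ q → count q ((i , r) ∷ T) ≡ rows ss p q
  cnt q = trans (cong (δ r q +_) (e q)) (m+[n∸m]≡n δ≤)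
    where
    δ≤ : δ r q ≤ rows ss p q
    δ≤ with r ≟ q
    ... | yes refl rewrite a = z<s
    ... | no _ = z≤n
  c≡ : count r T ≡ c
  c≡ = trans (e r) (trans (cong (rows ss p r ∸_) (δ-refl r)) (cong (_∸ 1) a))
  IH = decode-run ss p ((i , r) ∷ T) v os (o ∷ All.map All.tail ls) (All.map All.head ls ∷ so)
    ((λ q → subst₂ _≤_ (sym (cnt (suc q))) (sym (cnt q)) (rows-decreasing ss p v q)) , l) cnt
  R = proj₁ IH
  eq = proj₂ IH
decode-run (closes j ∷ ss) ((r , c) ∷ p) T′ (a , b , v) (o ∷ os) ls so l e
  with x , T , I , so₁ , l₁ ← uninsert r T′ so l (subst₂ _<_
      (sym (trans (e (suc r)) (cong (_+ rows ss p (suc r)) (δ-≢ (1+n≢n ∘ sym)))))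
    (sym (trans (e r) (cong (_+ rows ss p r) (δ-refl r)))) (s≤s (rows-decreasing ss p v r)))
  rewrite extract-ins j I = subst (λ c → Run (cl x j ∷ decode T ss p) T′ ((r , c) ∷ p)) (trans (cnt r) a)
      (close′ I R) , cong (_ ∷_) eq
  where
  cnt : ∀ q → count q T ≡ rows ss p q
  cnt q = +-cancelˡ-≡ (δ r q) _ _ (trans (sym (ins-count I q)) (e q))
  IH = decode-run ss p T v os (All.map All.tail (proj₂ (ins-all⁻ {P = λ x → All (opens x ≪_) (closes j ∷ ss)} I ls)))
      so₁ l₁ cnt
  R = proj₁ IH
  eq = proj₂ IH

-- Runs and the arcs pending in them

private variable
  u : List (Event n)
  p : Path

ins-fresh : Ins x T T′ r → All (λ e → x ≢ proj₁ e) T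
ins-fresh (stop a) = All.map (λ lt e → Finₚ.<⇒≢ lt (sym e)) a
ins-fresh (pass lt _ I) = Finₚ.<⇒≢ lt ∷ ins-fresh I
ins-fresh (push lt I) = Finₚ.<⇒≢ lt ∷ ins-fresh I

Opened : Fin n → Tableau n → Set
Opened x T = ∃ λ r → (x , r) ∈ T

ins-opened : Ins x T T′ r → Opened x T′ × (∀ {y} → Opened y T → Opened y T′)
ins-opened {x = x} {T′ = T′} I = let a , b = ins-all⁻ {P = λ y → Opened y T′} I (All.tabulate (_ ,_)) in a , λ (_ , m) → All.lookup b m

ins-opened⁻ : Ins x T T′ r → Opened y T′ → y ≡ x ⊎ Opened y T
ins-opened⁻ {x = x} {T = T} I (_ , m) = All.lookup
    (ins-all {P = λ y → y ≡ x ⊎ Opened y T} I (inj₁ refl) (All.tabulate (λ m → inj₂ (_ , m)))) m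

Ordered : List (Event n) → Set
Ordered u = AllPairs _≪_ (map slot u)

-- Every label in the tableau still awaits an opening to the left of all of `u`.
Fits : Tableau n → List (Event n) → Set
Fits T u = All (λ e → All (opens (proj₁ e) ≪_) (map slot u)) T

fits-open : Ordered (op i ∷ u) → Fits T (op i ∷ u) → Fits ((i , r) ∷ T) u
fits-open (o ∷ _) f = o ∷ All.map All.tail f

fits-close : Ins i T T′ r → Fits T′ (cl i j ∷ u) → Fits T u
fits-close {i = i} {j = j} {u = u} I f = All.map All.tail
    (proj₂ (ins-all⁻ {P = λ x → All (opens x ≪_) (map slot (cl i j ∷ u))} I f))

slot-∈ : ∀ {e} {P : Slot n → Set} → All P (map slot u) → e ∈ u → P (slot e)
slot-∈ a m = All.lookup a (∈-map⁺ slot m)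

run-closes : Run u T p → Opened x T ⊎ op x ∈ u → ∃ λ j → cl x j ∈ u
run-closes (open′ R) (inj₁ (r , m)) = let j , k = run-closes R (inj₁ (r , there m)) in j , there k
run-closes (open′ R) (inj₂ (here refl)) = let j , k = run-closes R (inj₁ (_ , here refl)) in j , there k
run-closes (open′ R) (inj₂ (there m)) = let j , k = run-closes R (inj₂ m) in j , there k
run-closes (close′ I R) (inj₁ o) with ins-opened⁻ I o
... | inj₁ refl = _ , here refl
... | inj₂ o′ = let j , k = run-closes R (inj₁ o′) in j , there k
run-closes (close′ I R) (inj₂ (there m)) = let j , k = run-closes R (inj₂ m) in j , there k

run-opened : Run u T p → cl x j ∈ u → Opened x T ⊎ op x ∈ u
run-opened (open′ R) (there m) with run-opened R m
... | inj₁ (_ , here refl) = inj₂ (here refl)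
... | inj₁ (r , there k) = inj₁ (r , k)
... | inj₂ k = inj₂ (there k)
run-opened (close′ I R) (here refl) = inj₁ (proj₁ (ins-opened I))
run-opened (close′ I R) (there m) with run-opened R m
... | inj₁ o = inj₁ (proj₂ (ins-opened I) o)
... | inj₂ k = inj₂ (there k)

run-≤ : Run u T p → Ordered u → Fits T u → cl x j ∈ u → x Fin.≤ j
run-≤ (open′ R) o f (there m) = run-≤ R (AllPairs.tail o) (fits-open o f) m
run-≤ {x = x} (close′ I R) o f (here refl) with _ , m ← proj₁ (ins-opened I) = All.head (All.lookup f m)
run-≤ (close′ {j = j} I R) o f (there m) = run-≤ R (AllPairs.tail o) (fits-close {j = j} I f) m

-- A further closing with label `i` would leave `i` either in the tableau, against freshness, or
-- already opened within `u`, against `Fits`.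
close-last : Ins i T T′ r → Run u T p → Fits T′ (cl i j ∷ u) → ∀ {j′} → ¬ cl i j′ ∈ u
close-last {j = j} I R f m with run-opened R m
... | inj₁ (_ , k) = All.lookup (ins-fresh I) k refl
... | inj₂ k with _ , l ← proj₁ (ins-opened I) = <-irrefl refl (slot-∈ (All.tail (All.lookup f l)) k)

run-closes-once : ∀ {j j′} → Run u T p → Ordered u → Fits T u → cl x j ∈ u → cl x j′ ∈ u → j ≡ j′
run-closes-once (open′ R) o f (there m) (there m′) = run-closes-once R (AllPairs.tail o) (fits-open o f) m m′
run-closes-once (close′ {j = j} I R) o f (there m) (there m′) =
    run-closes-once R (AllPairs.tail o) (fits-close {j = j} I f) m m′
run-closes-once (close′ I R) o f (here refl) (here refl) = refl
run-closes-once (close′ {j = j} I R) o f (here refl) (there m) = contradiction m (close-last {j = j} I R f)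
run-closes-once (close′ {j = j} I R) o f (there m) (here refl) = contradiction m (close-last {j = j} I R f)

pending : List (Event n) → Arcs n
pending [] = []
pending (op i ∷ u) = filter (λ a → ¬? (proj₁ a Fin.≟ i)) (pending u)
pending (cl i j ∷ u) = (i , j) ∷ pending u

-- Insertion of a smaller letter acts on the tail regardless of the head, by the form of the local
-- rules. Hence erasing the largest letter from the word erases just the head entry.
rsk-delete : ∀ {D s} → Rsk D ((i , s) ∷ T) → Rsk (filter (λ a → ¬? (proj₁ a Fin.≟ i)) D) T
rsk-delete {i = i} (_∷_ {j = j} {D = D} (stop a) R)
  rewrite filter-reject (λ a → ¬? (proj₁ a Fin.≟ i)) {(i , j)} {D} (λ ne → ne refl)
        | filter-all (λ a → ¬? (proj₁ a Fin.≟ i)) (rsk-all {P = _≢ i} R (All.map Finₚ.<⇒≢ a)) = R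
rsk-delete {i = i} (_∷_ {x} {j} {D} (pass lt _ I) R)
  rewrite filter-accept (λ a → ¬? (proj₁ a Fin.≟ i)) {(x , j)} {D} (Finₚ.<⇒≢ lt) = I ∷ rsk-delete R
rsk-delete {i = i} (_∷_ {x} {j} {D} (push lt I) R)
  rewrite filter-accept (λ a → ¬? (proj₁ a Fin.≟ i)) {(x , j)} {D} (Finₚ.<⇒≢ lt) = I ∷ rsk-delete R

run-rsk : Run u T p → Rsk (pending u) T
run-rsk [] = []
run-rsk (open′ R) = rsk-delete (run-rsk R)
run-rsk (close′ I R) = I ∷ run-rsk R

pending-⊆ : ∀ (u : List (Event n)) → (x , j) ∈ pending u → cl x j ∈ u
pending-⊆ (op i ∷ u) m = there (pending-⊆ u (proj₁ (∈-filter⁻ (λ a → ¬? (proj₁ a Fin.≟ i)) m)))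
pending-⊆ (cl i j ∷ u) (here refl) = here refl
pending-⊆ (cl i j ∷ u) (there m) = there (pending-⊆ u m)

pending-⊇ : ∀ (u : List (Event n)) → cl x j ∈ u → ¬ op x ∈ u → (x , j) ∈ pending u
pending-⊇ (op i ∷ u) (there m) ∉ = ∈-filter⁺ (λ a → ¬? (proj₁ a Fin.≟ i)) (pending-⊇ u m (∉ ∘ there))
    (λ { refl → ∉ (here refl) })
pending-⊇ (cl i j ∷ u) (here refl) ∉ = here refl
pending-⊇ (cl i j ∷ u) (there m) ∉ = there (pending-⊇ u m (∉ ∘ there))

_◂_ : Fin n × Fin n → Fin n × Fin n → Set
a ◂ b = proj₂ a Fin.< proj₂ b

pending-ordered : ∀ (u : List (Event n)) → Ordered u → AllPairs _◂_ (pending u)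
pending-ordered [] _ = []
pending-ordered (op i ∷ u) (_ ∷ o) = AllPairsₚ.filter⁺ _ (pending-ordered u o)
pending-ordered (cl i j ∷ u) (a ∷ o) = All.tabulate (λ m → slot-∈ a (pending-⊆ u m)) ∷ pending-ordered u o

-- Comparing all pairs avoids naming the extreme endpoints, which sit differently in crossings and
-- nestings.
Overlapping : Arcs n → Set
Overlapping xs = All (λ a → All (λ b → proj₁ a Fin.≤ proj₂ b) xs) xs

pending-overlapping : Run u T p → Fits T u → ∀ {xs} → All (_∈ pending u) xs → Overlapping xs
pending-overlapping {u = u} R f ms = All.map (λ m →
    All.map (λ m′ → slot-∈ (All.lookup labels m) (pending-⊆ u m′)) ms) ms
  where
  labels = rsk-all {P = λ x → All (opens x ≪_) (map slot u)} (run-rsk R) f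

module Statistic (_⊏_ : Fin n × Fin n → Fin n × Fin n → Set) where

  ChainIn : List (Event n) → ℕ → Set
  ChainIn u k = ∃ λ xs → length xs ≡ k × AllPairs (λ a b → a ⊏ b × a ◂ b) xs × All (λ (i , j) → cl i j ∈ u) xs ×
      Overlapping xs

  weaken : ∀ {e u k} → ChainIn u k → ChainIn (e ∷ u) k
  weaken (xs , l , ch , ms , o) = xs , l , ch , All.map there ms , o

  closes-later : ∀ {u i j a} → All (closes j ≪_) (map slot u) → cl (proj₁ a) (proj₂ a) ∈ u →
    ∀ {d} → (a ⊏ d × a ◂ d) × cl (proj₁ d) (proj₂ d) ∈ cl i j ∷ u → cl (proj₁ d) (proj₂ d) ∈ u
  closes-later b m ((_ , lt) , here refl) = contradiction (slot-∈ b m) (<⇒≯ lt)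
  closes-later b m (_ , there m′) = m′

  -- The closing event of the first arc of the chain is the moment at which all its arcs are open.
  chain-pending : ∀ {u T p} a xs → Run u T p → Ordered u → AllPairs (λ a b → a ⊏ b × a ◂ b) (a ∷ xs) →
      All (λ (i , j) → cl i j ∈ u) (a ∷ xs) →
    Overlapping (a ∷ xs) → ∃ λ u′ → ∃₂ λ T′ p′ → Run u′ T′ p′ × Ordered u′ ×
        (∀ {P : ℕ × ℕ → Set} → Any P p′ → Any P p) × All (_∈ pending u′) (a ∷ xs)
  chain-pending a xs [] _ _ (() ∷ _) _
  chain-pending a xs (open′ R) (_ ∷ o) ch ms ov
    with u′ , T′ , p′ , R′ , o′ , i , ps ← chain-pending a xs R o ch (All.map (λ { (there m) → m }) ms) ov = u′ , T′ ,
        p′ , R′ , o′ , there ∘ i , ps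
  chain-pending (i , j) xs (close′ {u} I R) (b ∷ o) (c ∷ ch) (here refl ∷ ms) ((_ ∷ _) ∷ ov) =
    _ , _ , _ , close′ I R , b ∷ o , (λ z → z) , here refl ∷ All.map there
        (All.zipWith (λ {a} → inside a) (c , All.zip (ms , All.map All.head ov)))
    where
    inside : ∀ a → ((i , j) ⊏ a × (i , j) ◂ a) × cl (proj₁ a) (proj₂ a) ∈ (cl i j ∷ u) × proj₁ a Fin.≤ j → a ∈ pending u
    inside _ ((_ , lt) , here refl , _) = contradiction lt (<-irrefl refl)
    inside _ (_ , there m , le) = pending-⊇ u m (λ k → <⇒≱ (slot-∈ b k) le)
  chain-pending a xs (close′ {u} {i} {j} I R) (b ∷ o) (c ∷ ch) (there m ∷ ms) ov
    with u′ , T′ , p′ , R′ , o′ , inc , ps ← chain-pending a xs R o (c ∷ ch)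
        (m ∷ All.zipWith (λ {d} → closes-later b m {d}) (c , ms)) ov = u′ , T′ , p′ , R′ , o′ , there ∘ inc , ps

-- The relations are written so that they coincide literally with the chain conditions of `Up` and
-- `Down`.
module Crossing {n} = Statistic {n} (λ a b → suc (toℕ (proj₁ a)) ≤ toℕ (proj₁ b))
module Nesting {n} = Statistic {n} (λ a b → toℕ (proj₁ b) < toℕ (proj₁ a))

letters-bounded : ∀ (T : Tableau n) w → ∃ λ v → w ≤ v × All (λ e → proj₂ e < v) T
letters-bounded [] w = w , ≤-refl , []
letters-bounded ((_ , s) ∷ T) w with v , le , a ← letters-bounded T (w ⊔ suc s) = v , ≤-trans (m≤m⊔n _ _) le ,
    ≤-trans (m≤n⊔m _ _) le ∷ a

run-crossing : ∀ {m q} → Run u T p → Ordered u → Fits T u → m ≤ q → 0 < count q T → Crossing.ChainIn u (suc m)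
run-crossing {u = u} {T = T} {m = m} {q} R o f m≤q k
  -- The bound must exceed `q`, for the lattice word, and all row indices, for `rsk-climb`.
  with v , le , a ← letters-bounded T (suc q)
  with xs , l , ch , _ , ms ← Up.longest⇒chain (suc m) 0 (pending u) (pending-ordered u o)
    (≤-trans (s≤s m≤q) (≤-trans (lattice-climb T (run-lattice R) q k)
        (≤-trans (Slow.mono (climb-slow T 0) le) (≤-reflexive (rsk-climb (run-rsk R) 0 v a)))))
  = xs , l , ch , All.map (pending-⊆ u) ms , pending-overlapping R f ms

lattice-count : ∀ (T : Tableau n) → Lattice T → ∀ q → count q T ≤ count 0 T
lattice-count T l zero = ≤-refl
lattice-count T l (suc q) = ≤-trans (lattice-≤ T l q) (lattice-count T l q)

zeros-n : ∀ (T : Tableau n) → zeros T n ≡ count 0 T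
zeros-n T = zeros-all {T = T} (All.tabulate (λ {e} _ → Finₚ.toℕ<n (proj₁ e)))

run-nesting : ∀ {n} {u : List (Event n)} {T p m q} → Run u T p → Ordered u → Fits T u → m < count q T →
    Nesting.ChainIn u (suc m)
run-nesting {n = n} {u = u} {T = T} {m = m} {q} R o f k
  with xs , l , ch , _ , ms ← Down.longest⇒chain (suc m) n (pending u) (pending-ordered u o)
    (≤-trans k (≤-trans (lattice-count T (run-lattice R) q)
        (≤-reflexive (trans (sym (zeros-n T)) (rsk-zeros (run-rsk R) n)))))
  = xs , l , ch , All.map (pending-⊆ u) ms , pending-overlapping R f ms

δ-pos : ∀ q (T : Tableau n) → 0 < δ q q + count q T
δ-pos q T rewrite δ-refl q = z<s

path-crossing : ∀ {m} → Run u T p → Ordered u → Fits T u → Any (λ b → m ≤ proj₁ b) p → Crossing.ChainIn u (suc m)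
-- The removed box still belongs to the tableau of the shorter word, before the opening is read.
path-crossing (open′ {r = r} {T = T} R) o f (here le) =
    Crossing.weaken (run-crossing R (AllPairs.tail o) (fits-open o f) le (δ-pos r T))
path-crossing (open′ R) o f (there a) = Crossing.weaken (path-crossing R (AllPairs.tail o) (fits-open o f) a)
path-crossing (close′ {r = r} {T = T} I R) o f (here le) =
    run-crossing (close′ I R) o f le (subst (0 <_) (sym (ins-count I r)) (δ-pos r T))
path-crossing (close′ {j = j} I R) o f (there a) =
    Crossing.weaken (path-crossing R (AllPairs.tail o) (fits-close {j = j} I f) a)

δ-more : ∀ {m} q (T : Tableau n) → m ≤ count q T → m < δ q q + count q T
δ-more q T le rewrite δ-refl q = s≤s le

path-nesting : ∀ {m} → Run u T p → Ordered u → Fits T u → Any (λ b → m ≤ proj₂ b) p → Nesting.ChainIn u (suc m)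
path-nesting (open′ {r = r} {T = T} R) o f (here le) =
    Nesting.weaken (run-nesting {q = r} R (AllPairs.tail o) (fits-open o f) (δ-more r T le))
path-nesting (open′ R) o f (there a) = Nesting.weaken (path-nesting R (AllPairs.tail o) (fits-open o f) a)
path-nesting {m = m} (close′ {r = r} {T = T} I R) o f (here le) =
    run-nesting {q = r} (close′ I R) o f (subst (m <_) (sym (ins-count I r)) (δ-more r T le))
path-nesting (close′ {j = j} I R) o f (there a) = Nesting.weaken
    (path-nesting R (AllPairs.tail o) (fits-close {j = j} I f) a)

-- The walk starts at the empty shape, so an occupied row received a box at some closing.
count-path : ∀ {q} → Run u T p → 0 < count q T → Any (λ b → q ≤ proj₁ b) p
count-path {q = q} (open′ {r = r} R) k = there (count-path R (≤-trans k (m≤n+m _ (δ r q))))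
count-path {q = q} (close′ {r = r} {T = T} I R) k with r ≟ q
... | yes refl = here ≤-refl
... | no r≢q = there (count-path R (subst (0 <_) (trans (ins-count I q) (cong (_+ count q T) (δ-≢ r≢q))) k))

zeros-path : ∀ {m} → Run u T p → m < count 0 T → Any (λ b → m ≤ proj₂ b) p
zeros-path (open′ {r = r} R) k = there (zeros-path R (≤-trans k (m≤n+m _ (δ r 0))))
zeros-path {m = m} (close′ {r = r} {T = T} I R) k rewrite ins-count I 0 with r ≟ 0
... | no _ = there (zeros-path R k)
... | yes refl with m <? count 0 T
... | yes lt = there (zeros-path R lt)
... | no ≮ = here (≤-pred k)

letter-≥ : ∀ (T : Tableau n) m → ¬ All (λ e → proj₂ e < m) T → ∃ λ q → m ≤ q × 0 < count q T
letter-≥ [] m ≰ = contradiction [] ≰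
letter-≥ ((y , s) ∷ T) m ≰ with s <? m
... | no ≮ = s , ≮⇒≥ ≮ , δ-pos s T
... | yes lt with q , le , k ← letter-≥ T m (≰ ∘ (lt ∷_)) = q , le , ≤-trans k (m≤n+m _ (δ s q))

crossing-path : ∀ {m} → Run u T p → Ordered u → Crossing.ChainIn u (suc m) → Any (λ b → m ≤ proj₁ b) p
crossing-path {m = m} R o (a ∷ xs , refl , ch , ms , ov)
  with u′ , T′ , p′ , R′ , o′ , inc , ps ← Crossing.chain-pending a xs R o ch ms ov
  -- Were all row indices below `m`, `climb` would be at most `m`, less than the length of the
  -- chain.
  with q , le , k ← letter-≥ T′ m (λ b → <⇒≱ (Up.chain⇒longest {Q = _◂_} <⇒≯ 0 (a ∷ xs) (pending-ordered u′ o′) ch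
      (All.tabulate (λ _ → z≤n)) ps)
    (≤-trans (≤-reflexive (sym (rsk-climb (run-rsk R′) 0 m b))) (climb-≤ T′ 0 m)))
  = Any.map (≤-trans le) (inc (count-path R′ k))

nesting-path : ∀ {n} {u : List (Event n)} {T p m} → Run u T p → Ordered u → Nesting.ChainIn u (suc m) →
    Any (λ b → m ≤ proj₂ b) p
nesting-path {n = n} {m = m} R o (a ∷ xs , refl , ch , ms , ov)
  with u′ , T′ , p′ , R′ , o′ , inc , ps ← Nesting.chain-pending a xs R o ch ms ov
  = inc (zeros-path R′ (≤-trans (Down.chain⇒longest {Q = _◂_} <⇒≯ n (a ∷ xs) (pending-ordered u′ o′) ch
      (All.tabulate (λ {e} _ → Finₚ.toℕ<n (proj₁ e))) ps)
    (≤-reflexive (trans (sym (rsk-zeros (run-rsk R′) n)) (zeros-n T′)))))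

insertable : ∀ (x : Fin n) T → All (λ e → x ≢ proj₁ e) T → Sorted T → ∃₂ λ T′ r → Ins x T T′ r
insertable x [] _ _ = _ , _ , stop []
insertable x ((y , s) ∷ T) (x≢y ∷ ne) (a ∷ so) with Finₚ.<-cmp x y
... | tri≈ _ e _ = contradiction e x≢y
... | tri> _ _ gt = _ , _ , stop (gt ∷ All.map (λ lt → <-trans lt gt) a)
... | tri< lt _ _ with T′ , r , I ← insertable x T ne so with s ≟ r
... | yes refl = _ , _ , push lt I
... | no s≢r = _ , _ , pass lt s≢r I

close-unique : ∀ {u : List (Event n)} {i i′ j} → Ordered u → cl i j ∈ u → cl i′ j ∈ u → i ≡ i′
close-unique _ (here refl) (here refl) = refl
close-unique {u = _ ∷ _} (o ∷ _) (here refl) (there m) = contradiction (slot-∈ o m) (<-irrefl refl)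
close-unique {u = _ ∷ _} (o ∷ _) (there m) (here refl) = contradiction (slot-∈ o m) (<-irrefl refl)
close-unique {u = _ ∷ _} (_ ∷ os) (there m) (there m′) = close-unique os m m′

-- With the slots fixed only the left ends at closings are free, and an ordered word has one closing
-- per right end; so inclusion of the closings suffices.
word-≡ : ∀ (u v : List (Event n)) → map slot u ≡ map slot v → Ordered v → (∀ {i j} → cl i j ∈ u → cl i j ∈ v) → u ≡ v
word-≡ [] [] _ _ _ = refl
word-≡ (op i ∷ u) (op i′ ∷ v) eq (_ ∷ os) f with refl ← ∷-injectiveˡ eq =
  cong (_ ∷_) (word-≡ u v (∷-injectiveʳ eq) os (λ m → Any.tail (λ ()) (f (there m))))
word-≡ (cl i j ∷ u) (cl i′ j′ ∷ v) eq os@(o ∷ os′) f with refl ← ∷-injectiveˡ eq =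
  cong₂ (λ i u → cl i j ∷ u) (close-unique os (f (here refl)) (here refl))
    (word-≡ u v (∷-injectiveʳ eq) os′ λ m → Any.tail
        (λ { refl → <-irrefl refl (slot-∈ (subst (All (closes j ≪_)) (sym (∷-injectiveʳ eq)) o) m) }) (f (there m)))

op-transfer : ∀ {u v : List (Event n)} {i} → map slot u ≡ map slot v → op i ∈ u → op i ∈ v
op-transfer e m with ∈-map⁻ slot (subst (_ ∈_) e (∈-map⁺ slot m))
... | op _ , m′ , refl = m′

cl-transfer : ∀ {u v : List (Event n)} {i j} → map slot u ≡ map slot v → cl i j ∈ u → ∃ λ i′ → cl i′ j ∈ v
cl-transfer e m with ∈-map⁻ slot (subst (_ ∈_) e (∈-map⁺ slot m))
... | cl _ _ , m′ , refl = _ , m′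

-- Conjugation of words

conjugate : List (Event n) → List (Event n)
conjugate u = decode [] (map slot u) (transpose (proj₂ (encode u)))

module _ {u : List (Event n)} {p} (R : Run u [] p) (o : Ordered u) where
  private
    v = run-valid R
    ss = map slot u

    conjugate-≡ : conjugate u ≡ decode [] ss (transpose p)
    conjugate-≡ = cong (decode [] ss ∘ transpose ∘ proj₂) (run-encode R)

    decoded : Run (decode [] ss (transpose p)) [] (transpose p) × map slot (decode [] ss (transpose p)) ≡ ss
    decoded = decode-run ss (transpose p) [] (valid-transpose ss p v) o [] [] _
      -- By `galois⁻` a box in column `q` of the final shape would force a box into row 0, but the
      -- run ends with the empty tableau.
      (λ q → sym (n≤0⇒n≡0 (≮⇒≥ (λ lt → contradiction
          (subst (q <_) (sym (run-count R 0)) (galois⁻ ss p v 0 q lt)) λ ()))))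

  conjugate-run : Run (conjugate u) [] (transpose p)
  conjugate-run = subst (λ w → Run w [] (transpose p)) (sym conjugate-≡) (proj₁ decoded)

  conjugate-slots : map slot (conjugate u) ≡ ss
  conjugate-slots = trans (cong (map slot) conjugate-≡) (proj₂ decoded)

  conjugate-ordered : Ordered (conjugate u)
  conjugate-ordered = subst (AllPairs _≪_) (sym conjugate-slots) o

conjugate-involutive : ∀ {u : List (Event n)} {p} → Run u [] p → Ordered u → conjugate (conjugate u) ≡ u
conjugate-involutive {p = p} R o = trans (cong₂ (decode []) (conjugate-slots R o)
  (trans (cong (transpose ∘ proj₂) (run-encode (conjugate-run R o))) (transpose-involutive p))) (run-decode R)

-- Colour classes

Colouring : ℕ → ℕ → Set
Colouring n k = Fin n → Fin n → Maybe (Fin k)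

-- Uniqueness holds across colours, which is what allows the separately conjugated colour classes to
-- be merged again.
record Matching {n k} (Φ : Colouring n k) : Set where
  field
    row-unique : ∀ {i j j′ c c′} → Φ i j ≡ just c → Φ i j′ ≡ just c′ → j ≡ j′
    col-unique : ∀ {i i′ j c c′} → Φ i j ≡ just c → Φ i′ j ≡ just c′ → i ≡ i′
    forward    : ∀ {i j c} → Φ i j ≡ just c → i Fin.≤ j
open Matching

module Word {n k} (Φ : Colouring n k) (c : Fin k) where

  arc? : ∀ i j → Dec (Φ i j ≡ just c)
  arc? i j = Maybeₚ.≡-dec Fin._≟_ (Φ i j) (just c)

  row? : ∀ i → Dec (∃ λ j → Φ i j ≡ just c)
  row? i = Finₚ.any? (arc? i)

  col? : ∀ j → Dec (∃ λ i → Φ i j ≡ just c)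
  col? j = Finₚ.any? (λ i → arc? i j)

  opening : Fin n → List (Event n)
  opening j with row? j
  ... | yes _ = op j ∷ []
  ... | no _  = []

  closing : Fin n → List (Event n)
  closing j with col? j
  ... | yes (i , _) = cl i j ∷ []
  ... | no _        = []

  wordOn : List (Fin n) → List (Event n)
  wordOn [] = []
  wordOn (j ∷ js) = opening j ++ closing j ++ wordOn js

  word : List (Event n)
  word = wordOn (allFin n)

  wordOn-cl⁻ : ∀ {i j} js → cl i j ∈ wordOn js → j ∈ js × Φ i j ≡ just c
  wordOn-cl⁻ (j ∷ js) m with row? j | col? j
  wordOn-cl⁻ (j ∷ js) (there (here refl)) | yes _ | yes (i , e) = here refl , e
  wordOn-cl⁻ (j ∷ js) (there (there m)) | yes _ | yes (i , e) = let a , b = wordOn-cl⁻ js m in there a , b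
  wordOn-cl⁻ (j ∷ js) (there m) | yes _ | no _ = let a , b = wordOn-cl⁻ js m in there a , b
  wordOn-cl⁻ (j ∷ js) (here refl) | no _ | yes (i , e) = here refl , e
  wordOn-cl⁻ (j ∷ js) (there m) | no _ | yes (i , e) = let a , b = wordOn-cl⁻ js m in there a , b
  wordOn-cl⁻ (j ∷ js) m | no _ | no _ = let a , b = wordOn-cl⁻ js m in there a , b

  wordOn-op⁻ : ∀ {i} js → op i ∈ wordOn js → i ∈ js × ∃ λ j → Φ i j ≡ just c
  wordOn-op⁻ (j ∷ js) m with row? j | col? j
  wordOn-op⁻ (j ∷ js) (here refl) | yes e | _ = here refl , e
  wordOn-op⁻ (j ∷ js) (there (there m)) | yes _ | yes (i , e) = let a , b = wordOn-op⁻ js m in there a , b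
  wordOn-op⁻ (j ∷ js) (there m) | yes _ | no _ = let a , b = wordOn-op⁻ js m in there a , b
  wordOn-op⁻ (j ∷ js) (there m) | no _ | yes (i , e) = let a , b = wordOn-op⁻ js m in there a , b
  wordOn-op⁻ (j ∷ js) m | no _ | no _ = let a , b = wordOn-op⁻ js m in there a , b

  wordOn-cl : Matching Φ → ∀ {i j js} → j ∈ js → Φ i j ≡ just c → cl i j ∈ wordOn js
  wordOn-cl M {i} {j} (here refl) e = ∈-++⁺ʳ (opening j) (∈-++⁺ˡ now)
    where
    now : cl i j ∈ closing j
    now with col? j
    ... | yes (i′ , e′) with refl ← col-unique M e e′ = here refl
    ... | no ∄ = contradiction (i , e) ∄
  wordOn-cl M {js = j′ ∷ _} (there m) e = ∈-++⁺ʳ (opening j′) (∈-++⁺ʳ (closing j′) (wordOn-cl M m e))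

  wordOn-op : ∀ {i j js} → i ∈ js → Φ i j ≡ just c → op i ∈ wordOn js
  wordOn-op {i} {j} {_ ∷ js} (here refl) e = ∈-++⁺ˡ now
    where
    now : op i ∈ opening i
    now with row? i
    ... | yes _ = here refl
    ... | no ∄ = contradiction (j , e) ∄
  wordOn-op {js = j′ ∷ _} (there m) e = ∈-++⁺ʳ (opening j′) (∈-++⁺ʳ (closing j′) (wordOn-op m e))

  word-cl⁻ : ∀ {i j} → cl i j ∈ word → Φ i j ≡ just c
  word-cl⁻ m = proj₂ (wordOn-cl⁻ (allFin n) m)

  word-cl : Matching Φ → ∀ {i j} → Φ i j ≡ just c → cl i j ∈ word
  word-cl M = wordOn-cl M (∈-allFin _)

  wordOn-after : ∀ js {j} → All (j Fin.<_) js → All (opens j ≪_) (map slot (wordOn js)) ×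
      All (closes j ≪_) (map slot (wordOn js))
  wordOn-after js a = Allₚ.map⁺ (All.tabulate after) , Allₚ.map⁺ (All.tabulate after′)
    where
    after : ∀ {e} → e ∈ wordOn js → opens _ ≪ slot e
    after {op _} m = All.lookup a (proj₁ (wordOn-op⁻ js m))
    after {cl _ _} m = <⇒≤ (All.lookup a (proj₁ (wordOn-cl⁻ js m)))
    after′ : ∀ {e} → e ∈ wordOn js → closes _ ≪ slot e
    after′ {op _} m = All.lookup a (proj₁ (wordOn-op⁻ js m))
    after′ {cl _ _} m = All.lookup a (proj₁ (wordOn-cl⁻ js m))

  wordOn-ordered : ∀ js → AllPairs Fin._<_ js → Ordered (wordOn js)
  wordOn-ordered [] _ = []
  wordOn-ordered (j ∷ js) (a ∷ as) with wordOn-after js a | wordOn-ordered js as | row? j | col? j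
  ... | os , cs | o | yes _ | yes _ = (≤-refl ∷ os) ∷ cs ∷ o
  ... | os , cs | o | yes _ | no _  = os ∷ o
  ... | os , cs | o | no _  | yes _ = cs ∷ o
  ... | os , cs | o | no _  | no _  = o

  allFin-sorted : AllPairs Fin._<_ (allFin n)
  allFin-sorted = AllPairsₚ.tabulate⁺-< (λ lt → lt)

  word-ordered : Ordered word
  word-ordered = wordOn-ordered (allFin n) allFin-sorted

  module _ (M : Matching Φ) where

    -- A final segment of the ground set.
    UpTo : List (Fin n) → Set
    UpTo js = ∀ i → i ∈ js ⊎ All (i Fin.<_) js

    -- The labels are the left ends of arcs already closed and not yet opened. `P` records which
    -- openings are still to come, as this changes between the closing and the opening of one
    -- element.
    Labelled : Tableau n → (Fin n → Set) → List (Fin n) → Set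
    Labelled T P js = ∀ i → Opened i T ⇔ (P i × ∃ λ j → j ∈ js × Φ i j ≡ just c)

    upTo-≤ : ∀ {i j js} → UpTo (j ∷ js) → All (i Fin.<_) js → i Fin.≤ j
    upTo-≤ {i} up b with up i
    ... | inj₁ (here refl) = ≤-refl
    ... | inj₁ (there m) = contradiction (All.lookup b m) (<-irrefl refl)
    ... | inj₂ (lt ∷ _) = <⇒≤ lt

    upTo-tail : ∀ {j js} → All (j Fin.<_) js → UpTo (j ∷ js) → UpTo js
    upTo-tail a up i with up i
    ... | inj₁ (here refl) = inj₂ a
    ... | inj₁ (there m) = inj₁ m
    ... | inj₂ (_ ∷ b) = inj₂ b

    not-yet-opened : ∀ {x j js T} {P : Fin n → Set} → All (j Fin.<_) js → Labelled T P js → Φ x j ≡ just c →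
        All (λ e → x ≢ proj₁ e) T
    not-yet-opened {x} {j} a L ex = All.tabulate fresh
      where
      fresh : ∀ {e} → e ∈ _ → x ≢ proj₁ e
      fresh m refl with _ , j′ , k , e ← to (L x) (_ , m) with refl ← row-unique M e ex = <-irrefl refl (All.lookup a k)

    closing-run : ∀ {j js T p} → All (j Fin.<_) js → UpTo (j ∷ js) → Run (wordOn js) T p →
        Labelled T (λ i → All (i Fin.<_) js) js →
      ∃₂ λ T′ p′ → Run (closing j ++ wordOn js) T′ p′ × Labelled T′ (Fin._≤ j) (j ∷ js)
    closing-run {j} {js} {T} {p} a up R L with col? j
    ... | no ∄ = T , p , R , λ i → mk⇔
        (λ o → let b , j′ , m , e = to (L i) o in upTo-≤ up b , j′ , there m , e)
        (λ { (le , j′ , here refl , e) → contradiction (i , e) ∄ ; (le , j′ , there m , e) →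
            from (L i) (All.map (≤-<-trans le) a , j′ , m , e) })
    ... | yes (x , ex) with T′ , r , I ← insertable x T (not-yet-opened a L ex) (run-sorted R) = T′ , _ , close′ I R ,
        λ i → mk⇔
        (λ o → label i (ins-opened⁻ I o))
        (λ { (le , j′ , here refl , e) → subst (λ y → Opened y T′) (col-unique M ex e) (proj₁ (ins-opened I))
           ; (le , j′ , there m , e) → proj₂ (ins-opened I) (from (L i) (All.map (≤-<-trans le) a , j′ , m , e)) })
      where
      label : ∀ i → i ≡ x ⊎ Opened i T → i Fin.≤ j × ∃ λ j′ → j′ ∈ j ∷ js × Φ i j′ ≡ just c
      label i (inj₁ refl) = forward M ex , j , here refl , ex
      label i (inj₂ o) = let b , j′ , m , e = to (L i) o in upTo-≤ up b , j′ , there m , e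

    -- This is why an opening may delete the largest label: all labels present are at most `j`, and
    -- `j` is among them.
    head-label : ∀ {j js e T} → Sorted (e ∷ T) → Labelled (e ∷ T) (Fin._≤ j) js → Opened j (e ∷ T) → proj₁ e ≡ j
    head-label so L (_ , here refl) = refl
    head-label (lt ∷ _) L (_ , there m) = contradiction (proj₁ (to (L _) (_ , here refl))) (<⇒≱ (All.lookup lt m))

    opening-run : ∀ {j js T p u} → All (j Fin.<_) js → UpTo (j ∷ js) → Run u T p → Labelled T (Fin._≤ j) (j ∷ js) →
      ∃₂ λ T′ p′ → Run (opening j ++ u) T′ p′ × Labelled T′ (λ i → All (i Fin.<_) (j ∷ js)) (j ∷ js)
    opening-run {j} {js} {T} a up R L with row? j
    opening-run {j} {js} {T} a up R L | no ∄ = T , _ , R , λ i → mk⇔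
        (λ o → let le , j′ , m , e = to (L i) o ; lt = Finₚ.≤∧≢⇒< le (λ { refl → ∄ (j′ , e) }) in lt ∷ All.map (<-trans lt) a , j′ , m , e)
        (λ { (lt ∷ _ , r) → from (L i) (<⇒≤ lt , r) })
    opening-run {j} {js} {T} a up R L | yes (j₀ , e₀) = go T R L (from (L j) (≤-refl , j₀ , j₀∈ , e₀))
      where
      j₀∈ : j₀ ∈ j ∷ js
      j₀∈ with up j₀
      ... | inj₁ m = m
      ... | inj₂ (lt ∷ _) = contradiction (forward M e₀) (<⇒≱ lt)
      go : ∀ {u p} T → Run u T p → Labelled T (Fin._≤ j) (j ∷ js) → Opened j T →
        ∃₂ λ T′ p′ → Run (op j ∷ u) T′ p′ × Labelled T′ (λ i → All (i Fin.<_) (j ∷ js)) (j ∷ js)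
      go [] R L (_ , ())
      go ((y , s) ∷ T) R L o with refl ← head-label (run-sorted R) L o = T , _ , open′ R , λ i → mk⇔
        (λ (_ , m) → let lt = All.lookup (AllPairs.head (run-sorted R)) m in lt ∷ All.map (<-trans lt) a , proj₂ (to (L i) (_ , there m)))
        (λ { (lt ∷ _ , r) → strip lt (from (L i) (<⇒≤ lt , r)) })
        where
        strip : ∀ {i} → i Fin.< j → Opened i ((j , s) ∷ T) → Opened i T
        strip lt (_ , here refl) = contradiction lt (<-irrefl refl)
        strip lt (_ , there m) = _ , m

    wordOn-run : ∀ js → AllPairs Fin._<_ js → UpTo js → ∃₂ λ T p → Run (wordOn js) T p ×
        Labelled T (λ i → All (i Fin.<_) js) js
    wordOn-run [] _ _ = [] , [] , [] , λ i → mk⇔ (λ { (_ , ()) }) (λ { (_ , _ , () , _) })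
    wordOn-run (j ∷ js) (a ∷ as) up
      with T , p , R , L ← wordOn-run js as (upTo-tail a up)
      with T′ , p′ , R′ , L′ ← closing-run a up R L = opening-run a up R′ L′

    word-run : ∃ λ p → Run word [] p
    word-run with wordOn-run (allFin n) allFin-sorted (λ i → inj₁ (∈-allFin i))
    ... | [] , p , R , _ = p , R
    -- A label left over would lie below every element, itself included.
    ... | (y , s) ∷ T , _ , _ , L = contradiction (All.lookup (proj₁ (to (L y) (s , here refl))) (∈-allFin y))
        (<-irrefl refl)

open Word using (word; wordOn; word-cl; word-cl⁻; word-run; word-ordered)

_≟ᴱ_ : (e e′ : Event n) → Dec (e ≡ e′)
op i ≟ᴱ op i′ = map′ (cong op) (λ { refl → refl }) (i Fin.≟ i′)
op _ ≟ᴱ cl _ _ = no λ ()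
cl _ _ ≟ᴱ op _ = no λ ()
cl i j ≟ᴱ cl i′ j′ = map′ (λ { (refl , refl) → refl }) (λ { refl → refl , refl }) (i Fin.≟ i′ ×-dec j Fin.≟ j′)

module Conjugate {n k} (Φ : Colouring n k) where
  open import Data.List.Membership.DecPropositional (_≟ᴱ_ {n}) using (_∈?_)

  word′ : Fin k → List (Event n)
  word′ c = conjugate (word Φ c)

  -- The search over colours gives a value for every colouring; for a matching at most one colour
  -- qualifies, by `same-colour`.
  conjugated : Colouring n k
  conjugated i j with Finₚ.any? (λ c → cl i j ∈? word′ c)
  ... | yes (c , _) = just c
  ... | no _ = nothing

  conjugated-cl : ∀ {i j c} → conjugated i j ≡ just c → cl i j ∈ word′ c
  conjugated-cl {i} {j} e with Finₚ.any? (λ c → cl i j ∈? word′ c)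
  conjugated-cl refl | yes (c , m) = m

  module _ (M : Matching Φ) where

    path : Fin k → Path
    path c = proj₁ (word-run Φ c M)

    run : ∀ c → Run (word Φ c) [] (path c)
    run c = proj₂ (word-run Φ c M)

    run′ : ∀ c → Run (word′ c) [] (transpose (path c))
    run′ c = conjugate-run (run c) (word-ordered Φ c)

    slots′ : ∀ c → map slot (word′ c) ≡ map slot (word Φ c)
    slots′ c = conjugate-slots (run c) (word-ordered Φ c)

    ordered′ : ∀ c → Ordered (word′ c)
    ordered′ c = conjugate-ordered (run c) (word-ordered Φ c)

    col-support : ∀ {i j c} → cl i j ∈ word′ c → ∃ λ i′ → Φ i′ j ≡ just c
    col-support {c = c} m = let i′ , m′ = cl-transfer (slots′ c) m in i′ , word-cl⁻ Φ c m′

    col-support⁻ : ∀ {i j c} → Φ i j ≡ just c → ∃ λ i′ → cl i′ j ∈ word′ c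
    col-support⁻ {c = c} e = cl-transfer (sym (slots′ c)) (word-cl Φ c M e)

    row-support : ∀ {i j c} → cl i j ∈ word′ c → ∃ λ j′ → Φ i j′ ≡ just c
    row-support {c = c} m with run-opened (run′ c) m
    ... | inj₂ m′ = proj₂ (Word.wordOn-op⁻ Φ c (allFin n) (op-transfer (slots′ c) m′))

    row-support⁻ : ∀ {i j c} → Φ i j ≡ just c → ∃ λ j′ → cl i j′ ∈ word′ c
    row-support⁻ {c = c} e = run-closes (run′ c) (inj₂
        (op-transfer (sym (slots′ c)) (Word.wordOn-op Φ c (∈-allFin _) e)))

    -- Conjugation keeps the right ends of each colour, and in `Φ` an element closes an arc of one
    -- colour only.
    same-colour : ∀ {i i′ j c c′} → cl i j ∈ word′ c → cl i′ j ∈ word′ c′ → c ≡ c′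
    same-colour m m′ with i₁ , e₁ ← col-support m with i₂ , e₂ ← col-support m′ with refl ← col-unique M e₁ e₂ =
        just-injective (trans (sym e₁) e₂)

    cl-conjugated : ∀ {i j c} → cl i j ∈ word′ c → conjugated i j ≡ just c
    cl-conjugated {i} {j} {c} m with Finₚ.any? (λ c → cl i j ∈? word′ c)
    ... | yes (c′ , m′) = cong just (same-colour m′ m)
    ... | no ∄ = contradiction (c , m) ∄

    -- `Ψ` stands for the entries of a tabulated matrix, which agree with `conjugated` only
    -- pointwise.
    module _ {Ψ : Colouring n k} (Ψ≗conjugated : ∀ i j → Ψ i j ≡ conjugated i j) where

      private
        Ψ-cl : ∀ {i j c} → Ψ i j ≡ just c → cl i j ∈ word′ c
        Ψ-cl {i} {j} e = conjugated-cl (trans (sym (Ψ≗conjugated i j)) e)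

        cl-Ψ : ∀ {i j c} → cl i j ∈ word′ c → Ψ i j ≡ just c
        cl-Ψ {i} {j} m = trans (Ψ≗conjugated i j) (cl-conjugated m)

      matching′ : Matching Ψ
      row-unique matching′ {c = c} e e′ with m ← Ψ-cl e with m′ ← Ψ-cl e′
        with j₁ , e₁ ← row-support m with j₂ , e₂ ← row-support m′ with refl ← row-unique M e₁ e₂ with refl ←
            just-injective (trans (sym e₁) e₂) =
        run-closes-once (run′ c) (ordered′ c) [] m m′
      col-unique matching′ {c = c} e e′ with m ← Ψ-cl e with m′ ← Ψ-cl e′ with refl ← same-colour m m′ =
          close-unique (ordered′ c) m m′
      forward matching′ {c = c} e = run-≤ (run′ c) (ordered′ c) [] (Ψ-cl e)

      row-⇔ : ∀ {i c} → (∃ λ j → Φ i j ≡ just c) ⇔ (∃ λ j → Ψ i j ≡ just c)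
      row-⇔ = mk⇔ (λ (_ , e) → let j , m = row-support⁻ e in j , cl-Ψ m) (λ (_ , e) → row-support (Ψ-cl e))

      col-⇔ : ∀ {j c} → (∃ λ i → Φ i j ≡ just c) ⇔ (∃ λ i → Ψ i j ≡ just c)
      col-⇔ = mk⇔ (λ (_ , e) → let i , m = col-support⁻ e in i , cl-Ψ m) (λ (_ , e) → col-support (Ψ-cl e))

      slots-Ψ : ∀ c js → map slot (wordOn Ψ c js) ≡ map slot (wordOn Φ c js)
      slots-Ψ c [] = refl
      slots-Ψ c (j ∷ js) with Word.row? Ψ c j | Word.row? Φ c j | Word.col? Ψ c j | Word.col? Φ c j
      ... | yes _ | yes _ | yes _ | yes _ = cong (λ ss → _ ∷ _ ∷ ss) (slots-Ψ c js)
      ... | yes _ | yes _ | no _  | no _  = cong (_ ∷_) (slots-Ψ c js)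
      ... | no _  | no _  | yes _ | yes _ = cong (_ ∷_) (slots-Ψ c js)
      ... | no _  | no _  | no _  | no _  = slots-Ψ c js
      ... | yes r | no ∄r | _ | _ = contradiction (from row-⇔ r) ∄r
      ... | no ∄r | yes r | _ | _ = contradiction (to row-⇔ r) ∄r
      ... | _ | _ | yes r | no ∄r = contradiction (from col-⇔ r) ∄r
      ... | _ | _ | no ∄r | yes r = contradiction (to col-⇔ r) ∄r

      -- Reading the new colouring as a word returns the conjugated word, so conjugating twice can
      -- be computed on words.
      word-Ψ : ∀ c → word Ψ c ≡ word′ c
      word-Ψ c = word-≡ (word Ψ c) (word′ c) (trans (slots-Ψ c (allFin n)) (sym (slots′ c))) (ordered′ c) (λ m →
          Ψ-cl (word-cl⁻ Ψ c m))

      run-Ψ : ∀ c → Run (word Ψ c) [] (transpose (path c))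
      run-Ψ c = subst (λ u → Run u [] (transpose (path c))) (sym (word-Ψ c)) (run′ c)

      crossing⇔nesting : ∀ {c m} → Crossing.ChainIn (word Φ c) (suc m) ⇔ Nesting.ChainIn (word Ψ c) (suc m)
      crossing⇔nesting {c} = mk⇔
        (path-nesting (run-Ψ c) (word-ordered Ψ c) [] ∘ Anyₚ.map⁺ ∘ crossing-path (run c) (word-ordered Φ c))
        (path-crossing (run c) (word-ordered Φ c) [] ∘ Anyₚ.map⁻ ∘ nesting-path (run-Ψ c) (word-ordered Ψ c))

      nesting⇔crossing : ∀ {c m} → Nesting.ChainIn (word Φ c) (suc m) ⇔ Crossing.ChainIn (word Ψ c) (suc m)
      nesting⇔crossing {c} = mk⇔
        (path-crossing (run-Ψ c) (word-ordered Ψ c) [] ∘ Anyₚ.map⁺ ∘ nesting-path (run c) (word-ordered Φ c))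
        (path-nesting (run c) (word-ordered Φ c) [] ∘ Anyₚ.map⁻ ∘ crossing-path (run-Ψ c) (word-ordered Ψ c))

open Conjugate using (conjugated)

maybe-≡ : ∀ {A : Set} {a b : Maybe A} → (∀ {c} → a ≡ just c → b ≡ just c) → (∀ {c} → b ≡ just c → a ≡ just c) → a ≡ b
maybe-≡ {a = just _} f g = sym (f refl)
maybe-≡ {a = nothing} {just _} f g = g refl
maybe-≡ {a = nothing} {nothing} f g = refl

conjugated-involutive : ∀ {n k} {Φ Ψ : Colouring n k} → Matching Φ → (∀ i j → Ψ i j ≡ conjugated Φ i j) → ∀ i j →
    conjugated Ψ i j ≡ Φ i j
conjugated-involutive {Φ = Φ} {Ψ} M eq i j = maybe-≡
  (λ {c} e → word-cl⁻ Φ c (subst (cl i j ∈_) (twice c) (C.conjugated-cl e)))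
  (λ {c} e → C.cl-conjugated (matching′ M eq) (subst (cl i j ∈_) (sym (twice c)) (word-cl Φ c M e)))
  where
  open Conjugate Φ using (matching′; word-Ψ; run)
  module C = Conjugate Ψ
  twice : ∀ c → C.word′ c ≡ word Φ c
  twice c = trans (cong conjugate (word-Ψ M eq c)) (conjugate-involutive (run M c) (word-ordered Φ c))

-- Set partitions and their arcs

just⇒is-just : ∀ {A : Set} {m : Maybe A} {c} → m ≡ just c → True (is-just m)
just⇒is-just refl = _

is-just⇒just : ∀ {A : Set} (m : Maybe A) → True (is-just m) → ∃ λ c → m ≡ just c
is-just⇒just (just c) _ = c , refl

HasRow : Colouring n k → Fin n → Set
HasRow Φ i = ∃₂ λ c j → Φ i j ≡ just c

HasCol : Colouring n k → Fin n → Set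
HasCol Φ j = ∃₂ λ c i → Φ i j ≡ just c

module Partition {n} (R : BoolRel n) (P : IsSetPartition R) where
  open IsSetPartition P public

  _∼?_ : ∀ i j → Dec (i ∼[ R ] j)
  i ∼? j = T? _

  predecessor : ∀ {i k} → k Fin.< i → k ∼[ R ] i → ∃ λ p → Arc R p i
  predecessor {i} {k} = go (FinInd.>-wellFounded k)
    where
    go : ∀ {k} → Acc Fin._>_ k → k Fin.< i → k ∼[ R ] i → ∃ λ p → Arc R p i
    go {k} (acc rs) lt k∼i with Finₚ.any? (λ m → k Finₚ.<? m ×-dec m Finₚ.<? i ×-dec m ∼? i)
    ... | yes (m , k<m , m<i , m∼i) = go (rs k<m) m<i m∼i
    ... | no ∄ = k , lt , k∼i , λ l k<l l∼k → ≮⇒≥ (λ l<i → ∄ (l , k<l , l<i , transitive l k i l∼k k∼i))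

  successor : ∀ {i k} → i Fin.< k → k ∼[ R ] i → ∃ λ s → Arc R i s
  successor {i} {k} = go (FinInd.<-wellFounded k)
    where
    go : ∀ {k} → Acc Fin._<_ k → i Fin.< k → k ∼[ R ] i → ∃ λ s → Arc R i s
    go {k} (acc rs) lt k∼i with Finₚ.any? (λ m → i Finₚ.<? m ×-dec m Finₚ.<? k ×-dec m ∼? i)
    ... | yes (m , i<m , m<k , m∼i) = go (rs m<k) i<m m∼i
    ... | no ∄ = k , lt , symmetric k i k∼i , λ l i<l l∼i → ≮⇒≥ (λ l<k → ∄ (l , i<l , l<k , l∼i))

  min? : ∀ i → IsMin R i ⊎ ∃ λ p → Arc R p i
  min? i with Finₚ.any? (λ m → m Finₚ.<? i ×-dec m ∼? i)
  ... | yes (m , m<i , m∼i) = inj₂ (predecessor m<i m∼i)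
  ... | no ∄ = inj₁ λ m m∼i → ≮⇒≥ (λ m<i → ∄ (m , m<i , m∼i))

  max? : ∀ i → IsMax R i ⊎ ∃ λ s → Arc R i s
  max? i with Finₚ.any? (λ m → i Finₚ.<? m ×-dec m ∼? i)
  ... | yes (m , i<m , m∼i) = inj₂ (successor i<m m∼i)
  ... | no ∄ = inj₁ λ m m∼i → ≮⇒≥ (λ i<m → ∄ (m , i<m , m∼i))

  arc-¬min : ∀ {i j} → Arc R i j → ¬ IsMin R j
  arc-¬min {i} {j} (lt , i∼j , _) m = <⇒≱ lt (m i i∼j)

  arc-¬max : ∀ {i j} → Arc R i j → ¬ IsMax R i
  arc-¬max {i} {j} (lt , i∼j , _) m = <⇒≱ lt (m j (symmetric i j i∼j))

  enhanced-row-unique : ∀ {i j j′} → EnhancedArc R i j → EnhancedArc R i j′ → j ≡ j′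
  enhanced-row-unique {i} {j} {j′} (inj₁ (a , b , c)) (inj₁ (a′ , b′ , c′)) =
    Finₚ.≤-antisym (c j′ a′ (symmetric i j′ b′)) (c′ j a (symmetric i j b))
  enhanced-row-unique (inj₁ a) (inj₂ (_ , _ , m)) = contradiction m (arc-¬max a)
  enhanced-row-unique (inj₂ (_ , _ , m)) (inj₁ a) = contradiction m (arc-¬max a)
  enhanced-row-unique (inj₂ (refl , _)) (inj₂ (refl , _)) = refl

  enhanced-col-unique : ∀ {i i′ j} → EnhancedArc R i j → EnhancedArc R i′ j → i ≡ i′
  enhanced-col-unique {i} {i′} {j} (inj₁ (a , b , c)) (inj₁ (a′ , b′ , c′)) with Finₚ.<-cmp i i′
  ... | tri≈ _ e _ = e
  ... | tri< lt _ _ = contradiction (c i′ lt (transitive i′ j i b′ (symmetric i j b))) (<⇒≱ a′)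
  ... | tri> _ _ gt = contradiction (c′ i gt (transitive i j i′ b (symmetric i′ j b′))) (<⇒≱ a)
  enhanced-col-unique (inj₁ a) (inj₂ (refl , m , _)) = contradiction m (arc-¬min a)
  enhanced-col-unique (inj₂ (refl , m , _)) (inj₁ a) = contradiction m (arc-¬min a)
  enhanced-col-unique (inj₂ (refl , _)) (inj₂ (refl , _)) = refl

  enhanced-forward : ∀ {i j} → EnhancedArc R i j → i Fin.≤ j
  enhanced-forward (inj₁ (lt , _)) = <⇒≤ lt
  enhanced-forward (inj₂ (refl , _)) = ≤-refl

  module Coloured {k} (Φ : Colouring n k) (dom : ∀ i j → True (is-just (Φ i j)) ⇔ EnhancedArc R i j) where

    arc : ∀ {i j c} → Φ i j ≡ just c → EnhancedArc R i j
    arc e = to (dom _ _) (just⇒is-just e)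

    colour-of : ∀ {i j} → EnhancedArc R i j → ∃ λ c → Φ i j ≡ just c
    colour-of a = is-just⇒just _ (from (dom _ _) a)

    matching : Matching Φ
    matching = record
      { row-unique = λ e e′ → enhanced-row-unique (arc e) (arc e′)
      ; col-unique = λ e e′ → enhanced-col-unique (arc e) (arc e′)
      ; forward = λ e → enhanced-forward (arc e)
      }

    -- Only a singleton has no ordinary arc at it, and its loop covers it. This is the condition
    -- under which arcs determine a partition again.
    covered : ∀ i → HasRow Φ i ⊎ HasCol Φ i
    covered i with min? i | max? i
    ... | inj₂ (p , a) | _ = let c , e = colour-of (inj₁ a) in inj₂ (c , p , e)
    ... | _ | inj₂ (s , a) = let c , e = colour-of (inj₁ a) in inj₁ (c , s , e)
    ... | inj₁ mi | inj₁ ma = let c , e = colour-of (inj₂ (refl , mi , ma)) in inj₁ (c , i , e)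

    -- The set is read off the support of the colouring as the elements that open an arc and close
    -- none; a singleton does both through its loop.
    min∖max : ∀ i → (IsMin R i × ¬ IsMax R i) ⇔ (HasRow Φ i × ¬ HasCol Φ i)
    min∖max i = mk⇔ thither back
      where
      thither : IsMin R i × ¬ IsMax R i → HasRow Φ i × ¬ HasCol Φ i
      thither (mi , ¬ma) = row (max? i) , col
        where
        row : IsMax R i ⊎ (∃ λ s → Arc R i s) → HasRow Φ i
        row (inj₁ ma) = contradiction ma ¬ma
        row (inj₂ (s , a)) = let c , e = colour-of (inj₁ a) in c , s , e
        col : ¬ HasCol Φ i
        col (c , p , e) with arc e
        ... | inj₁ a = arc-¬min a mi
        ... | inj₂ (refl , _ , ma) = ¬ma ma
      back : HasRow Φ i × ¬ HasCol Φ i → IsMin R i × ¬ IsMax R i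
      back ((c , s , e) , ∄) = min (min? i) , max (arc e)
        where
        min : IsMin R i ⊎ (∃ λ p → Arc R p i) → IsMin R i
        min (inj₁ mi) = mi
        min (inj₂ (p , a)) = let c , e = colour-of (inj₁ a) in contradiction (c , p , e) ∄
        max : EnhancedArc R i s → ¬ IsMax R i
        max (inj₁ a) = arc-¬max a
        max (inj₂ (refl , _)) = contradiction (c , i , e) ∄

    max∖min : ∀ i → (IsMax R i × ¬ IsMin R i) ⇔ (HasCol Φ i × ¬ HasRow Φ i)
    max∖min i = mk⇔ thither back
      where
      thither : IsMax R i × ¬ IsMin R i → HasCol Φ i × ¬ HasRow Φ i
      thither (ma , ¬mi) = col (min? i) , row
        where
        col : IsMin R i ⊎ (∃ λ p → Arc R p i) → HasCol Φ i
        col (inj₁ mi) = contradiction mi ¬mi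
        col (inj₂ (p , a)) = let c , e = colour-of (inj₁ a) in c , p , e
        row : ¬ HasRow Φ i
        row (c , s , e) with arc e
        ... | inj₁ a = arc-¬max a ma
        ... | inj₂ (refl , mi , _) = ¬mi mi
      back : HasCol Φ i × ¬ HasRow Φ i → IsMax R i × ¬ IsMin R i
      back ((c , p , e) , ∄) = max (max? i) , min (arc e)
        where
        max : IsMax R i ⊎ (∃ λ s → Arc R i s) → IsMax R i
        max (inj₁ ma) = ma
        max (inj₂ (s , a)) = let c , e = colour-of (inj₁ a) in contradiction (c , s , e) ∄
        min : EnhancedArc R p i → ¬ IsMin R i
        min (inj₁ a) = arc-¬min a
        min (inj₂ (refl , _)) = contradiction (c , i , e) ∄

-- Recovering the blocks from the arcs

module Blocks {n k} (Φ : Colouring n k) where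

  -- Arcs are followed backwards to the minimum of the block; comparing roots is decidable, which
  -- gives the block relation as a Boolean matrix.
  data Root : Fin n → Fin n → Set where
    base : ∀ {j} → (∀ {i} → i Fin.< j → ¬ True (is-just (Φ i j))) → Root j j
    step : ∀ {i j r} → i Fin.< j → True (is-just (Φ i j)) → Root i r → Root j r

  root-total : ∀ j → ∃ (Root j)
  root-total j = go (FinInd.<-wellFounded j)
    where
    go : ∀ {j} → Acc Fin._<_ j → ∃ (Root j)
    go {j} (acc rs) with Finₚ.any? (λ i → i Finₚ.<? j ×-dec T? (is-just (Φ i j)))
    ... | yes (i , lt , t) = let r , ρ = go (rs lt) in r , step lt t ρ
    ... | no ∄ = j , base (λ lt t → ∄ (_ , lt , t))

  root : Fin n → Fin n
  root j = proj₁ (root-total j)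

  blocksOf : BoolRel n
  blocksOf = tabulate λ i → tabulate λ j → ⌊ root i Fin.≟ root j ⌋

  blocksOf-lookup : ∀ i j → lookup (lookup blocksOf i) j ≡ ⌊ root i Fin.≟ root j ⌋
  blocksOf-lookup i j = trans (cong (λ v → lookup v j) (Vecₚ.lookup∘tabulate _ i)) (Vecₚ.lookup∘tabulate _ j)

  ∼⇒root : ∀ {i j} → i ∼[ blocksOf ] j → root i ≡ root j
  ∼⇒root {i} {j} t = toWitness (subst True (blocksOf-lookup i j) t)

  root⇒∼ : ∀ {i j} → root i ≡ root j → i ∼[ blocksOf ] j
  root⇒∼ {i} {j} e = subst True (sym (blocksOf-lookup i j)) (fromWitness e)

  isSetPartition : IsSetPartition blocksOf
  isSetPartition = record
    { reflexive = λ i → root⇒∼ refl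
    ; symmetric = λ i j t → root⇒∼ (sym (∼⇒root t))
    ; transitive = λ i j l t t′ → root⇒∼ (trans (∼⇒root t) (∼⇒root t′))
    }

  root-≤ : ∀ {j r} → Root j r → r Fin.≤ j
  root-≤ (base _) = ≤-refl
  root-≤ (step lt _ ρ) = ≤-trans (root-≤ ρ) (<⇒≤ lt)

  module _ (M : Matching Φ) (cov : ∀ i → HasRow Φ i ⊎ HasCol Φ i) where

    private
      row-unique′ : ∀ {i j j′} → True (is-just (Φ i j)) → True (is-just (Φ i j′)) → j ≡ j′
      row-unique′ {i} {j} {j′} t t′ = row-unique M (proj₂ (is-just⇒just (Φ i j) t)) (proj₂ (is-just⇒just (Φ i j′) t′))

      col-unique′ : ∀ {i i′ j} → True (is-just (Φ i j)) → True (is-just (Φ i′ j)) → i ≡ i′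
      col-unique′ {i} {i′} {j} t t′ = col-unique M (proj₂ (is-just⇒just (Φ i j) t)) (proj₂ (is-just⇒just (Φ i′ j) t′))

    root-unique : ∀ {j r r′} → Root j r → Root j r′ → r ≡ r′
    root-unique (base _) (base _) = refl
    root-unique (base b) (step lt t _) = contradiction t (b lt)
    root-unique (step lt t _) (base b) = contradiction t (b lt)
    root-unique (step _ t ρ) (step _ t′ ρ′) with refl ← col-unique′ t t′ = root-unique ρ ρ′

    next-in-block : ∀ {l i r} → l Fin.< i → Root l r → Root i r → ∃ λ m → True (is-just (Φ l m)) × l Fin.< m × m Fin.≤ i
    next-in-block {i = i} = go (FinInd.<-wellFounded i)
      where
      go : ∀ {l i r} → Acc Fin._<_ i → l Fin.< i → Root l r → Root i r → ∃ λ m → True (is-just (Φ l m)) × l Fin.< m ×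
          m Fin.≤ i
      go _ lt ρ (base _) = contradiction (root-≤ ρ) (<⇒≱ lt)
      go {l} (acc rs) lt ρ (step {p} p<i t ρ′) with Finₚ.<-cmp l p
      ... | tri≈ _ refl _ = _ , t , lt , ≤-refl
      ... | tri< l<p _ _ = let m , t′ , l<m , m≤p = go (rs p<i) l<p ρ ρ′ in m , t′ , l<m , ≤-trans m≤p (<⇒≤ p<i)
      -- With the roles exchanged, the arc leaving `p` would land at or before `l`, yet it lands at
      -- the element beyond `l` that was stepped back from.
      ... | tri> _ _ p<l with m , t′ , _ , m≤l ← go (rs lt) p<l ρ′ ρ with refl ← row-unique′ t t′ =
          contradiction m≤l (<⇒≱ lt)

    next-∼ : ∀ {l i} → l Fin.< i → root l ≡ root i → ∃ λ m → True (is-just (Φ l m)) × l Fin.< m × m Fin.≤ i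
    next-∼ {l} {i} lt e = next-in-block lt (proj₂ (root-total l)) (subst (Root i) (sym e) (proj₂ (root-total i)))

    linked-root : ∀ {i j} → i Fin.< j → True (is-just (Φ i j)) → root i ≡ root j
    linked-root {i} {j} lt t = root-unique (step lt t (proj₂ (root-total i))) (proj₂ (root-total j))

    domain-to : ∀ i j → True (is-just (Φ i j)) → EnhancedArc blocksOf i j
    domain-to i j t with m≤n⇒m<n∨m≡n (forward M (proj₂ (is-just⇒just (Φ i j) t)))
    ... | inj₁ lt = inj₁ (lt , root⇒∼ (linked-root lt t) , least)
      where
      least : ∀ l → i Fin.< l → l ∼[ blocksOf ] i → j Fin.≤ l
      least l i<l l∼i with m , t′ , _ , m≤l ← next-∼ i<l (sym (∼⇒root l∼i)) with refl ← row-unique′ t t′ = m≤l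
    ... | inj₂ e with refl ← Finₚ.toℕ-injective e = inj₂ (refl , mi , ma)
      where
      no-pred : ∀ {l} → l Fin.< i → ¬ True (is-just (Φ l i))
      no-pred lt t′ with refl ← col-unique′ t t′ = <-irrefl refl lt
      mi : IsMin blocksOf i
      mi l l∼i = ≤-trans (≤-reflexive (cong toℕ (sym
          (trans (∼⇒root l∼i) (root-unique (proj₂ (root-total i)) (base no-pred)))))) (root-≤ (proj₂ (root-total l)))
      ma : IsMax blocksOf i
      ma l l∼i = ≮⇒≥ λ i<l → let m , t′ , i<m , _ = next-∼ i<l (sym (∼⇒root l∼i)) in <⇒≢ i<m (cong toℕ (row-unique′ t t′))

    domain-from : ∀ i j → EnhancedArc blocksOf i j → True (is-just (Φ i j))
    domain-from i j (inj₁ (lt , i∼j , least)) with m , t , i<m , m≤j ← next-∼ lt (∼⇒root i∼j)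
      with refl ← Finₚ.≤-antisym m≤j (least m i<m (root⇒∼ (sym (linked-root i<m t)))) = t
    -- The element has some arc by `cov`; being alone in its block, it can only have the loop.
    domain-from i .i (inj₂ (refl , mi , ma)) with cov i
    ... | inj₁ (c , s , e) with m≤n⇒m<n∨m≡n (forward M e)
    ...   | inj₁ lt = contradiction (ma s (root⇒∼ (sym (linked-root lt (just⇒is-just e))))) (<⇒≱ lt)
    ...   | inj₂ q with refl ← Finₚ.toℕ-injective q = just⇒is-just e
    domain-from i .i (inj₂ (refl , mi , ma)) | inj₂ (c , p , e) with m≤n⇒m<n∨m≡n (forward M e)
    ...   | inj₁ lt = contradiction (mi p (root⇒∼ (linked-root lt (just⇒is-just e)))) (<⇒≱ lt)
    ...   | inj₂ q with refl ← Finₚ.toℕ-injective q = just⇒is-just e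

    domain-⇔ : ∀ i j → True (is-just (Φ i j)) ⇔ EnhancedArc blocksOf i j
    domain-⇔ i j = mk⇔ (domain-to i j) (domain-from i j)

  module _ {R : BoolRel n} (P : IsSetPartition R) (dom : ∀ i j → True (is-just (Φ i j)) ⇔ EnhancedArc R i j) where
    open Partition R P

    -- The walk stops at an element without predecessor, hence at the block minimum. So `blocksOf`
    -- returns the blocks of a given partition.
    root-min : ∀ {j r} → Root j r → r ∼[ R ] j × IsMin R r
    root-min {j} (base b) with min? j
    ... | inj₁ mi = reflexive j , mi
    ... | inj₂ (p , a@(lt , _)) = contradiction (from (dom p j) (inj₁ a)) (b lt)
    root-min {j} {r} (step {i} lt t ρ) with to (dom i j) t
    ... | inj₁ (_ , i∼j , _) = let r∼i , mi = root-min ρ in transitive r i j r∼i i∼j , mi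
    ... | inj₂ (refl , _) = contradiction lt (<-irrefl refl)

    blocksOf-≡ : ∀ i j → lookup (lookup blocksOf i) j ≡ lookup (lookup R i) j
    blocksOf-≡ i j = Boolₚ.⇔→≡ (mk⇔ (to Boolₚ.T-≡ ∘ thither ∘ from Boolₚ.T-≡) (to Boolₚ.T-≡ ∘ back ∘ from Boolₚ.T-≡))
      where
      ρᵢ = proj₂ (root-total i)
      ρⱼ = proj₂ (root-total j)
      thither : i ∼[ blocksOf ] j → i ∼[ R ] j
      thither t = transitive i (root i) j (symmetric _ _ (proj₁ (root-min ρᵢ)))
          (subst (λ r → r ∼[ R ] j) (sym (∼⇒root t)) (proj₁ (root-min ρⱼ)))
      back : i ∼[ R ] j → i ∼[ blocksOf ] j
      back t = root⇒∼ (Finₚ.≤-antisym (proj₂ (root-min ρᵢ) (root j) (symmetric _ _ i∼j))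
          (proj₂ (root-min ρⱼ) (root i) i∼j))
        where
        i∼j : root i ∼[ R ] root j
        i∼j = transitive _ i _ (proj₁ (root-min ρᵢ)) (transitive i j _ t (symmetric _ _ (proj₁ (root-min ρⱼ))))

open Blocks using (blocksOf)

-- Conjugation of coloured partitions and their statistics

Matrix : Set → ℕ → Set
Matrix A n = Vec (Vec A n) n

entry : ∀ {A : Set} → Matrix A n → Fin n → Fin n → A
entry C i j = lookup (lookup C i) j

lookup-ext : ∀ {A : Set} {u v : Vec A n} → (∀ i → lookup u i ≡ lookup v i) → u ≡ v
lookup-ext {u = u} {v} e = trans (sym (Vecₚ.tabulate∘lookup u)) (trans (Vecₚ.tabulate-cong e) (Vecₚ.tabulate∘lookup v))

matrix-ext : ∀ {A : Set} {C D : Matrix A n} → (∀ i j → entry C i j ≡ entry D i j) → C ≡ D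
matrix-ext e = lookup-ext (λ i → lookup-ext (e i))

conjugateMatrix : Matrix (Maybe (Fin k)) n → Matrix (Maybe (Fin k)) n
conjugateMatrix C = tabulate λ i → tabulate λ j → conjugated (entry C) i j

conjugateMatrix-entry : ∀ (C : Matrix (Maybe (Fin k)) n) i j → entry (conjugateMatrix C) i j ≡ conjugated (entry C) i j
conjugateMatrix-entry C i j = trans (cong (λ v → lookup v j) (Vecₚ.lookup∘tabulate _ i)) (Vecₚ.lookup∘tabulate _ j)

conjugateMatrix-involutive : ∀ (C : Matrix (Maybe (Fin k)) n) → Matching (entry C) →
    conjugateMatrix (conjugateMatrix C) ≡ C
conjugateMatrix-involutive C M = matrix-ext (λ i j →
    trans (conjugateMatrix-entry (conjugateMatrix C) i j) (conjugated-involutive M (conjugateMatrix-entry C) i j))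

allPairs-lookup : ∀ {A : Set} {R : A → A → Set} {xs} → AllPairs R xs → ∀ {s t} → s Fin.< t →
    R (List.lookup xs s) (List.lookup xs t)
allPairs-lookup (a ∷ _) {Fin.zero} {Fin.suc t} _ = All.lookup a (∈-lookup t)
allPairs-lookup (_ ∷ as) {Fin.suc s} {Fin.suc t} (s≤s lt) = allPairs-lookup as lt

opposite-< : ∀ {s t : Fin n} → s Fin.< t → opposite t Fin.< opposite s
opposite-< {n} {s} {t} lt = subst₂ _<_ (sym (Finₚ.opposite-prop t)) (sym (Finₚ.opposite-prop s))
    (∸-monoʳ-< (s≤s lt) (Finₚ.toℕ<n t))

module _ {m n : ℕ} {f : Fin (suc m) → Fin n} where

  increasing-≤-last : (∀ s t → s Fin.< t → f s Fin.< f t) → ∀ s → f s Fin.≤ f (fromℕ m)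
  increasing-≤-last inc s with m≤n⇒m<n∨m≡n (Finₚ.≤fromℕ s)
  ... | inj₁ lt = <⇒≤ (inc s _ lt)
  ... | inj₂ e = ≤-reflexive (cong (toℕ ∘ f) (Finₚ.toℕ-injective e))

  increasing-≥-first : (∀ s t → s Fin.< t → f s Fin.< f t) → ∀ t → f Fin.zero Fin.≤ f t
  increasing-≥-first inc Fin.zero = ≤-refl
  increasing-≥-first inc (Fin.suc t) = <⇒≤ (inc _ _ z<s)

  decreasing-≥-last : (∀ s t → s Fin.< t → f t Fin.< f s) → ∀ s → f (fromℕ m) Fin.≤ f s
  decreasing-≥-last dec s with m≤n⇒m<n∨m≡n (Finₚ.≤fromℕ s)
  ... | inj₁ lt = <⇒≤ (dec s _ lt)
  ... | inj₂ e = ≤-reflexive (cong (toℕ ∘ f) (sym (Finₚ.toℕ-injective e)))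

module Stats {n k} (Λ : ColoredEnhancedPartition n k) (P : IsSetPartition (ColoredEnhancedPartition.blocks Λ))
  (dom : ∀ i j → True (is-just (φ Λ i j)) ⇔ EnhancedArc (ColoredEnhancedPartition.blocks Λ) i j) where
  open Partition (ColoredEnhancedPartition.blocks Λ) P using (module Coloured)
  open Coloured (φ Λ) dom public

  overlaps : ∀ {xs : Arcs n} → Overlapping xs → ∀ s t → proj₁ (List.lookup xs s) Fin.≤ proj₂ (List.lookup xs t)
  overlaps ov s t = All.lookup (All.lookup ov (∈-lookup s)) (∈-lookup t)

  hasCrossing⇔ : ∀ m → HasCrossing Λ (suc m) ⇔ (∃ λ c → Crossing.ChainIn (word (φ Λ) c) (suc m))
  hasCrossing⇔ m = mk⇔ thither back
    where
    thither : HasCrossing Λ (suc m) → ∃ λ c → Crossing.ChainIn (word (φ Λ) c) (suc m)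
    thither (c , is , js , arcs , incI , incJ , le) = c , List.tabulate (λ t → is t , js t) ,
        length-tabulate (λ t → is t , js t) ,
      AllPairsₚ.tabulate⁺-< (λ lt → incI _ _ lt , incJ _ _ lt) ,
          Allₚ.tabulate⁺ (λ t → word-cl (φ Λ) c matching (proj₂ (arcs t))) ,
      -- Left ends are at most the last one and right ends at least the first, so one inequality
      -- yields all pairs.
      Allₚ.tabulate⁺ {f = λ t → is t , js t} (λ s →
          Allₚ.tabulate⁺ {f = λ t → is t , js t} (λ t →
              ≤-trans (increasing-≤-last incI s) (≤-trans le (increasing-≥-first incJ t))))
    back : (∃ λ c → Crossing.ChainIn (word (φ Λ) c) (suc m)) → HasCrossing Λ (suc m)
    back (c , xs@(_ ∷ _) , refl , ch , ms , ov) = c , proj₁ ∘ List.lookup xs , proj₂ ∘ List.lookup xs ,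
      (λ t → let e = word-cl⁻ (φ Λ) c (All.lookup ms (∈-lookup {xs = xs} t)) in arc e , e) ,
      (λ s t lt → proj₁ (allPairs-lookup ch lt)) , (λ s t lt → proj₂ (allPairs-lookup ch lt)) ,
          overlaps ov (fromℕ m) Fin.zero

  -- Chains are listed by increasing right endpoint, the reverse of the indexing in HasNesting.
  hasNesting⇔ : ∀ m → HasNesting Λ (suc m) ⇔ (∃ λ c → Nesting.ChainIn (word (φ Λ) c) (suc m))
  hasNesting⇔ m = mk⇔ thither back
    where
    thither : HasNesting Λ (suc m) → ∃ λ c → Nesting.ChainIn (word (φ Λ) c) (suc m)
    thither (c , is , js , arcs , incI , decJ , le) = c , List.tabulate (λ t → is (opposite t) , js (opposite t)) ,
        length-tabulate (λ t → is (opposite t) , js (opposite t)) ,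
      AllPairsₚ.tabulate⁺-< (λ lt → incI _ _ (opposite-< lt) , decJ _ _ (opposite-< lt)) ,
      Allₚ.tabulate⁺ (λ t → word-cl (φ Λ) c matching (proj₂ (arcs (opposite t)))) ,
      Allₚ.tabulate⁺ {f = λ t → is (opposite t) , js (opposite t)} (λ s →
          Allₚ.tabulate⁺ {f = λ t → is (opposite t) , js (opposite t)} (λ t →
        ≤-trans (increasing-≤-last incI (opposite s)) (≤-trans le (decreasing-≥-last decJ (opposite t)))))
    back : (∃ λ c → Nesting.ChainIn (word (φ Λ) c) (suc m)) → HasNesting Λ (suc m)
    back (c , xs@(_ ∷ _) , refl , ch , ms , ov) = c , proj₁ ∘ List.lookup xs ∘ opposite ,
        proj₂ ∘ List.lookup xs ∘ opposite ,
      (λ t → let e = word-cl⁻ (φ Λ) c (All.lookup ms (∈-lookup {xs = xs} (opposite t))) in arc e , e) ,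
      (λ s t lt → proj₁ (allPairs-lookup ch (opposite-< lt))) ,
          (λ s t lt → proj₂ (allPairs-lookup ch (opposite-< lt))) ,
      overlaps ov (opposite (fromℕ m)) (opposite (fromℕ m))

module ConjugatePartition {n k} (B : BoolRel n) (C : Matrix (Maybe (Fin k)) n) (P : IsSetPartition B)
  (dom : ∀ i j → True (is-just (entry C i j)) ⇔ EnhancedArc B i j) where

  Φ = entry C
  Ψ = entry (conjugateMatrix C)
  eq = conjugateMatrix-entry C
  open Partition.Coloured B P Φ dom using (matching; covered)
  open Conjugate Φ using (matching′; row-⇔; col-⇔; crossing⇔nesting; nesting⇔crossing)

  hasRow⇔ : ∀ i → HasRow Φ i ⇔ HasRow Ψ i
  hasRow⇔ i = mk⇔ (λ (c , e) → c , to (row-⇔ matching eq) e) (λ (c , e) → c , from (row-⇔ matching eq) e)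

  hasCol⇔ : ∀ i → HasCol Φ i ⇔ HasCol Ψ i
  hasCol⇔ i = mk⇔ (λ (c , e) → c , to (col-⇔ matching eq) e) (λ (c , e) → c , from (col-⇔ matching eq) e)

  P′ : IsSetPartition (blocksOf Ψ)
  P′ = Blocks.isSetPartition Ψ

  dom′ : ∀ i j → True (is-just (Ψ i j)) ⇔ EnhancedArc (blocksOf Ψ) i j
  dom′ = Blocks.domain-⇔ Ψ (matching′ matching eq) (λ i → Sum.map (to (hasRow⇔ i)) (to (hasCol⇔ i)) (covered i))

  blocks-≡ : blocksOf Φ ≡ B
  blocks-≡ = matrix-ext (Blocks.blocksOf-≡ Φ P dom)

  twice : conjugateMatrix (conjugateMatrix C) ≡ C
  twice = conjugateMatrix-involutive C matching

  Λ Λ′ : ColoredEnhancedPartition n k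
  Λ = mkCEP B C P dom
  Λ′ = mkCEP (blocksOf Ψ) (conjugateMatrix C) P′ dom′

  module S = Stats Λ P dom
  module S′ = Stats Λ′ P′ dom′

  cr⇔ne : ∀ m → HasCrossing Λ m ⇔ HasNesting Λ′ m
  cr⇔ne zero = mk⇔ id id
  cr⇔ne (suc m) = mk⇔
    (λ h → let c , ch = to (S.hasCrossing⇔ m) h in from (S′.hasNesting⇔ m) (c , to (crossing⇔nesting matching eq) ch))
    (λ h → let c , ch = to (S′.hasNesting⇔ m) h in from (S.hasCrossing⇔ m) (c , from (crossing⇔nesting matching eq) ch))

  ne⇔cr : ∀ m → HasNesting Λ m ⇔ HasCrossing Λ′ m
  ne⇔cr zero = mk⇔ id id
  ne⇔cr (suc m) = mk⇔
    (λ h → let c , ch = to (S.hasNesting⇔ m) h in from (S′.hasCrossing⇔ m) (c , to (nesting⇔crossing matching eq) ch))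
    (λ h → let c , ch = to (S′.hasCrossing⇔ m) h in from (S.hasNesting⇔ m) (c , from (nesting⇔crossing matching eq) ch))

  minMinusMax : ∀ S → MinMinusMaxIs Λ S → MinMinusMaxIs Λ′ S
  minMinusMax S h i = mk⇔
    (λ s → let a , b = to (S.min∖max i) (to (h i) s) in from (S′.min∖max i) (to (hasRow⇔ i) a , b ∘ from (hasCol⇔ i)))
    (λ q → let a , b = to (S′.min∖max i) q in from (h i) (from (S.min∖max i) (from (hasRow⇔ i) a , b ∘ to (hasCol⇔ i))))

  maxMinusMin : ∀ S → MaxMinusMinIs Λ S → MaxMinusMinIs Λ′ S
  maxMinusMin S h i = mk⇔
    (λ s → let a , b = to (S.max∖min i) (to (h i) s) in from (S′.max∖min i) (to (hasCol⇔ i) a , b ∘ from (hasRow⇔ i)))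
    (λ q → let a , b = to (S′.max∖min i) q in from (h i) (from (S.max∖min i) (from (hasCol⇔ i) a , b ∘ to (hasRow⇔ i))))

  class : ∀ {S T a b} → MinMinusMaxIs Λ S × MaxMinusMinIs Λ T × CrIs Λ a × NeIs Λ b → MinMinusMaxIs Λ′ S ×
      MaxMinusMinIs Λ′ T × CrIs Λ′ b × NeIs Λ′ a
  class {S} {T} {a} {b} (mi , ma , (cr , cr-max) , (ne , ne-max)) = minMinusMax S mi , maxMinusMin T ma ,
    (to (ne⇔cr b) ne , λ m → ne-max m ∘ from (ne⇔cr m)) , (to (cr⇔ne a) cr , λ m → cr-max m ∘ from (cr⇔ne m))

-- The involution on a class

_≟ᴮ_ : (B B′ : BoolRel n) → Dec (B ≡ B′)
_≟ᴮ_ = Vecₚ.≡-dec (Vecₚ.≡-dec Boolₚ._≟_)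

_≟ᶜ_ : (C C′ : Matrix (Maybe (Fin k)) n) → Dec (C ≡ C′)
_≟ᶜ_ = Vecₚ.≡-dec (Vecₚ.≡-dec (Maybeₚ.≡-dec Fin._≟_))

-- The proofs taken from the argument occur only in irrelevant positions of the result.
conjugateClass : ∀ {n k S T a b} → Class n k S T a b → Class n k S T b a
conjugateClass (mkCEP B C P dom , [ pf ]) = mkCEP (blocksOf (entry (conjugateMatrix C))) (conjugateMatrix C)
    (ConjugatePartition.P′ B C P dom) (ConjugatePartition.dom′ B C P dom) , [ ConjugatePartition.class B C P dom pf ]

class-≡ : ∀ {n k S T a b} {B B′ : BoolRel n} {C C′ : Matrix (Maybe (Fin k)) n} .{P P′ dom dom′ q q′} → B ≡ B′ → C ≡ C′ →
  _≡_ {A = Class n k S T a b} (mkCEP B C P dom , [ q ]) (mkCEP B′ C′ P′ dom′ , [ q′ ])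
class-≡ refl refl = refl

conjugateClass-involutive : ∀ {n k S T a b} (x : Class n k S T a b) → conjugateClass (conjugateClass x) ≡ x
conjugateClass-involutive (mkCEP B C P dom , [ pf ]) = class-≡ blocks-≡ twice
  where
  twice : conjugateMatrix (conjugateMatrix C) ≡ C
  -- The equation is available only from irrelevant proofs; decidable equality of matrices makes it
  -- relevant.
  twice = recompute (conjugateMatrix (conjugateMatrix C) ≟ᶜ C) (ConjugatePartition.twice B C P dom)
  blocks-≡ : blocksOf (entry (conjugateMatrix (conjugateMatrix C))) ≡ B
  blocks-≡ = trans (cong (λ C → blocksOf (entry C)) twice)
      (recompute (blocksOf (entry C) ≟ᴮ B) (ConjugatePartition.blocks-≡ B C P dom))

theorem5p7 : (n r : ℕ) → 1 ≤ n → 1 ≤ r → (S T : Subset n) → (a b : ℕ) →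
    Class n r S T a b ↔ Class n r S T b a
theorem5p7 n r _ _ S T a b = mk↔ₛ′ conjugateClass conjugateClass conjugateClass-involutive conjugateClass-involutive
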